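{- Let $k\geqslant p\geqslant 1$ and let $\tau\in\mathfrak S_k$ be an arbitrary $p$-layered pattern. Let $T=\{(1,2,3),\tau\}$ and $F_T(x)=\sum_{n\geqslant 0}|\mathfrak S_n(T)|x^n$. Then: (i) if $p=1$, then $F_T(x)$ is a polynomial of degree $2k-2$; (ii) if $p=2$, then $$F_T(x)=R_k(x):=\frac{U_{k-1}\left(\frac1{2\sqrt{x}}\right)}{\sqrt{x}\,U_{k}\left(\frac1{2\sqrt{x}}\right)},$$ where $U_r$ is the Chebyshev polynomial of the second kind, $U_r(\cos\theta)=\sin((r+1)\theta)/\sin\theta$; (iii) if $p\geqslant 3$, then $F_T(x)=\dfrac{1-\sqrt{1-4x}}{2x}$.
   Context: For permutations $\pi\in\mathfrak S_n$ and $\tau\in\mathfrak S_k$, an occurrence of $\tau$ in $\pi$ is a subsequence $1\leqslant i_1<\dots<i_k\leqslant n$ such that $(\pi_{i_1},\dots,\pi_{i_k})$ is order-isomorphic to $\tau$; $\pi$ avoids $\tau$ if there is no occurrence of $\tau$ in $\pi$. For a finite set of patterns $T$, $\mathfrak S_n(T)$ denotes the set of permutations in $\mathfrak S_n$ avoiding every pattern in $T$ (with $|\mathfrak S_0(T)|=1$). A permutation $\tau\in\mathfrak S_k$ is $p$-layered if it is the concatenation of $p$ nonempty consecutive substrings (layers) such that the entries decrease within each layer and every entry of a layer is smaller than every entry of any later layer; for $k_1,\dots,k_p\geqslant1$, $w(k_1,\dots,k_p)$ denotes the unique layered pattern of length $k_1+\dots+k_p$ whose $i$th layer has length $k_i$.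 -}

module Defs where

open import Data.Bool using (Bool; true; false; _∧_; if_then_else_)
open import Data.Nat using (ℕ; zero; suc; _+_; _*_; _∸_; _^_; _<ᵇ_; _≡ᵇ_; _/_; _%_)
open import Data.Nat.Combinatorics using (_C_)
open import Data.Integer using (ℤ; +_; -_) renaming (_+_ to _+ℤ_; _*_ to _*ℤ_; _-_ to _-ℤ_)
open import Data.List using (List; []; _∷_; map; concatMap; length; zip; filterᵇ; upTo; downFrom; _++_)
open import Data.Bool.ListAction using (all; any)
open import Data.Product using (_×_; _,_)

-- Permutations of length n are represented in one-line notation as lists
-- (π₁,…,πₙ) of naturals with values in {0,…,n-1}, all distinct.
-- (Values 0..n-1 instead of 1..n; irrelevant for pattern containment.)

words : ℕ → ℕ → List (List ℕ)
words n zero    = [] ∷ []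
words n (suc m) = concatMap (λ a → map (a ∷_) (words n m)) (upTo n)

distinctᵇ : List ℕ → Bool
distinctᵇ []       = true
distinctᵇ (x ∷ xs) = all (λ y → if x ≡ᵇ y then false else true) xs ∧ distinctᵇ xs

perms : ℕ → List (List ℕ)
perms n = filterᵇ distinctᵇ (words n n)

subseqs : List ℕ → List (List ℕ)
subseqs []       = [] ∷ []
subseqs (x ∷ xs) = map (x ∷_) (subseqs xs) ++ subseqs xs

boolEq : Bool → Bool → Bool
boolEq true  b = b
boolEq false true  = false
boolEq false false = true

orderIsoᵇ : List ℕ → List ℕ → Bool
orderIsoᵇ σ τ =
  (length σ ≡ᵇ length τ) ∧
  all (λ { (s , t) → all (λ { (s' , t') → boolEq (s <ᵇ s') (t <ᵇ t') }) z }) z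
  where z = zip σ τ

containsᵇ : List ℕ → List ℕ → Bool
containsᵇ τ π = any (λ σ → orderIsoᵇ σ τ) (subseqs π)

avoidsAllᵇ : List (List ℕ) → List ℕ → Bool
avoidsAllᵇ T π = all (λ τ → if containsᵇ τ π then false else true) T

avoidCount : List (List ℕ) → ℕ → ℕ
avoidCount T n = length (filterᵇ (avoidsAllᵇ T) (perms n))

layeredFrom : ℕ → List ℕ → List ℕ
layeredFrom b []       = []
layeredFrom b (m ∷ ks) = map (λ x → b + x) (downFrom m) ++ layeredFrom (b + m) ks

w : List ℕ → List ℕ
w ks = layeredFrom 0 ks

p123 : List ℕ
p123 = 0 ∷ 1 ∷ 2 ∷ []

-- Catalan numbers: n-th coefficient of (1 - √(1-4x))/(2x)
catalan : ℕ → ℕ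
catalan n = ((2 * n) C n) / suc n

-- Chebyshev polynomials of the second kind, via the standard recurrence
-- U₀ = 1, U₁ = 2y, U_{r+2} = 2y U_{r+1} - U_r.
-- Ucoef r i = coefficient of y^i in U_r(y).
Ucoef : ℕ → ℕ → ℤ
Ucoef zero          zero    = + 1
Ucoef zero          (suc i) = + 0
Ucoef (suc zero)    zero    = + 0
Ucoef (suc zero)    (suc zero) = + 2
Ucoef (suc zero)    (suc (suc i)) = + 0
Ucoef (suc (suc r)) zero    = - Ucoef r zero
Ucoef (suc (suc r)) (suc i) = (+ 2) *ℤ Ucoef (suc r) i -ℤ Ucoef r (suc i)

-- With t = √x:  t^r · U_r(1/(2t)) = Σ_{j ≤ r} Ucoef r (r-j) · 2^{-(r-j)} · t^j.
-- numCoef r j  =  2^r · (coefficient of t^j in t^r U_r(1/(2t)))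
--              =  Ucoef r (r-j) · 2^j   for j ≤ r, and 0 otherwise.
scaledRevCoef : ℕ → ℕ → ℤ
scaledRevCoef r j = if r <ᵇ j then + 0 else Ucoef r (r ∸ j) *ℤ (+ (2 ^ j))

conv : (ℕ → ℤ) → (ℕ → ℤ) → ℕ → ℤ
conv f g m = go (suc m)
  where
  go : ℕ → ℤ
  go zero    = + 0
  go (suc i) = f i *ℤ g (m ∸ i) +ℤ go i

-- coefficients of F_T(t²) as a power series in t
evenSpread : (ℕ → ℕ) → ℕ → ℤ
evenSpread a i = if (i % 2) ≡ᵇ 0 then + (a (i / 2)) else + 0

module Submission where

-- Permutations are built by prepending letters. Let j be the number of letters of v above a new
-- first letter a. Then a ∷ v contains 123 through a iff those j letters do not decrease, and it
-- contains w(L+1,S+1) through a iff L letters below a precede S+1 letters above a. Both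
-- conditions depend only on a short list of counts (the state of v), so the avoiders form a
-- generating tree. The number of n-step continuations of a state is a sum, over chains of
-- integers bounded by the state, of numbers of ballot paths below a ceiling; hence the avoiders
-- of length n are counted by Dyck paths of semilength n and height less than k = S+L+2, whatever
-- L and S. The three-term recurrence of these path numbers in the starting height is the
-- Chebyshev recurrence, which gives (ii). A layered pattern with at least three layers contains
-- 123, so in (iii) it may be replaced by w(1,n+1), for which the ceiling is not felt and the
-- reflection principle gives the Catalan number. In (i), the left-to-right minima of a
-- 123-avoiding permutation and the remaining letters are two decreasing sequences, which bounds
-- the length; w(k−1,k−1) attains the bound.

-- Letters are prepended because the smallest letter of 123 and the pivot of w(L+1,S+1) both come
-- first in their pattern: a new occurrence is then decided by the new letter and the letters above
-- it. The obstacle is that the tree is not visibly that of Dyck paths. Past its first S entries,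
-- the children of a state depend on the entries themselves and not only on their number. Instead of
-- a bijection there is an explicit formula for the number of continuations, and one identity,
-- `weight-suc`, checks it against the branching rule. In the formula a state with at most S entries
-- acts as the height of a path. A longer one acts as a path at height S that must begin with r
-- up-steps, where r is the last term of a chain. The recurrence in r deletes the peak after that
-- ascent, and the room L + 2 left above height S is what lets r range over 0, ..., L. At the root
-- only the ceiling S + (L + 2) remains, which is why the answer depends on k alone.

open import Data.Bool using (Bool; true; false; _∧_; if_then_else_; T; T?)
open import Data.Bool.ListAction using (all)
import Data.Bool.Properties as 𝔹ₚ
open import Data.List using (List; []; _∷_; [_]; _++_; length; map; drop; take; concatMap; filterᵇ; upTo; applyUpTo; downFrom; zip)
open import Data.List.Membership.Propositional using (_∈_)
open import Data.List.Membership.Propositional.Properties using (∈-filter⁺; ∈-concatMap⁺; ∈-map⁺; ∈-upTo⁺)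
open import Data.List.Properties using (length-map; length-++; length-drop; length-take; length-downFrom; map-∘; map-++; map-upTo; map-downFrom; map-cong-local; map-concatMap; concatMap-map; concatMap-cong; filter-++; drop-map; drop-all; drop-[]; drop-drop; ++-identityʳ; ++-assoc)
open import Data.List.Relation.Binary.Sublist.Propositional using (_⊆_; []; _∷_; _∷ʳ_; ⊆-refl; ⊆-trans; from∈)
import Data.List.Relation.Binary.Sublist.Propositional.Properties as Sublistₚ
open import Data.List.Relation.Unary.All as All using (All; []; _∷_)
import Data.List.Relation.Unary.All.Properties as Allₚ
open import Data.List.Relation.Unary.AllPairs as AllPairs using (AllPairs; []; _∷_)
import Data.List.Relation.Unary.AllPairs.Properties as AllPairsₚ
open import Data.List.Relation.Unary.Any as Any using (Any; here; there)
import Data.List.Relation.Unary.Any.Properties as Anyₚ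
open import Data.List.Relation.Unary.Unique.Propositional using (Unique)
open import Data.Nat as ℕ using (ℕ; zero; suc; _+_; _∸_; _*_; _/_; _%_; _^_; _≤_; _<_; _>_; _≤?_; _<ᵇ_; _≤ᵇ_; _≡ᵇ_; z≤n; s≤s)
open import Data.Nat.Combinatorics using (_C_; nCk+nC[k+1]≡[n+1]C[k+1]; nCk≡nC[n∸k]; nC1≡n; k>n⇒nCk≡0; nCn≡1)
open import Data.Nat.DivMod using (m/n≡1+[m∸n]/n; m*n/n≡m)
open import Data.Nat.ListAction using (sum)
open import Data.Nat.ListAction.Properties using (sum-++)
import Data.Nat.Properties as ℕₚ
open import Data.Nat.Tactic.RingSolver using (solve-∀)
open import Data.Product using (∃; ∃₂; _,_; _×_; proj₁; proj₂)
open import Data.Sum using (_⊎_; inj₁; inj₂)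
open import Data.Unit using (⊤; tt)
open import Defs
open import Function using (_∘_; Equivalence; _⇔_; mk⇔)
open import Relation.Binary.Definitions using (tri<; tri≈; tri>)
open import Relation.Binary.PropositionalEquality hiding ([_])
open import Relation.Nullary using (¬_; yes; no; contradiction)

open import Algebra.Properties.CommutativeSemigroup ℕₚ.+-commutativeSemigroup using (interchange; x∙yz≈y∙xz)

-- Ballot paths below a ceiling

-- Number of lattice paths with steps ±1 from height i to height 0 that have n up-steps and stay at
-- heights ≥ 0 and < i + e.
ballot : ℕ → ℕ → ℕ → ℕ
ballot zero    i       n       = 0
ballot (suc e) i       zero    = 1
ballot (suc e) zero    (suc n) = ballot e 1 n
ballot (suc e) (suc i) (suc n) = ballot (suc (suc e)) i (suc n) + ballot e (suc (suc i)) n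

nC0≡1 : ∀ n → n C 0 ≡ 1
nC0≡1 n = trans (nCk≡nC[n∸k] {0} {n} z≤n) (nCn≡1 n)

-- The rule (k+1)·C(n,k+1) = (n-k)·C(n,k) with the subtraction moved across. It turns the difference
-- of binomials from the reflection principle into the Catalan quotient.
absorption : ∀ n k → suc k * (n C suc k) + k * (n C k) ≡ n * (n C k)
absorption n zero rewrite nC1≡n n | nC0≡1 n = solve-n n
  where
  solve-n : ∀ n → 1 * n + 0 ≡ n * 1
  solve-n = solve-∀
absorption zero (suc k)
  rewrite k>n⇒nCk≡0 {0} {suc k} (s≤s z≤n) | k>n⇒nCk≡0 {0} {suc (suc k)} (s≤s z≤n) = solve-k k
  where
  solve-k : ∀ k → suc (suc k) * 0 + suc k * 0 ≡ 0
  solve-k = solve-∀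
absorption (suc n) (suc k)
  rewrite sym (nCk+nC[k+1]≡[n+1]C[k+1] n k) | sym (nCk+nC[k+1]≡[n+1]C[k+1] n (suc k))
  = combine (n C k) (n C suc k) (n C suc (suc k)) (absorption n k) (absorption n (suc k))
  where
  combine : ∀ a b c → suc k * b + k * a ≡ n * a → suc (suc k) * c + suc k * b ≡ n * b →
            suc (suc k) * (b + c) + suc k * (a + b) ≡ suc n * (a + b)
  combine a b c eqa eqb = begin
    suc (suc k) * (b + c) + suc k * (a + b)                          ≡⟨ regroup k a b c ⟩
    (suc k * b + k * a) + (suc (suc k) * c + suc k * b) + (a + b)    ≡⟨ cong₂ (λ x y → x + y + (a + b)) eqa eqb ⟩
    n * a + n * b + (a + b)                                          ≡⟨ collect n a b ⟩
    suc n * (a + b)                                                  ∎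
    where
    open ≡-Reasoning
    regroup : ∀ k a b c → suc (suc k) * (b + c) + suc k * (a + b) ≡
              (suc k * b + k * a) + (suc (suc k) * c + suc k * b) + (a + b)
    regroup = solve-∀
    collect : ∀ n a b → n * a + n * b + (a + b) ≡ suc n * (a + b)
    collect = solve-∀

private
  2*-suc : ∀ n → 2 * suc n ≡ suc (1 + 2 * n)
  2*-suc = solve-∀

-- The reflection principle.
ballot-binomial : ∀ e i n → suc n < e →
  ballot e i (suc n) + ((i + 2 * suc n) C n) ≡ (i + 2 * suc n) C suc n
ballot-binomial (suc zero)    zero zero (s≤s ())
ballot-binomial (suc (suc e)) zero zero _ = refl
ballot-binomial (suc e) zero (suc n) (s≤s n<e)
  rewrite cong (_C suc n) (2*-suc (suc n)) | cong (_C suc (suc n)) (2*-suc (suc n))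
        | sym (nCk+nC[k+1]≡[n+1]C[k+1] (1 + 2 * suc n) n)
        | sym (nCk+nC[k+1]≡[n+1]C[k+1] (1 + 2 * suc n) (suc n))
  = combine (ballot e 1 (suc n)) _ _ _ (ballot-binomial e 1 n n<e) middle
  where
  split : ∀ n → 1 + 2 * suc n ≡ suc (suc n) + suc n
  split = solve-∀
  -- The row is odd, so its two middle entries agree; this is how the forced up-step at the floor
  -- enters.
  middle : (1 + 2 * suc n) C suc n ≡ (1 + 2 * suc n) C suc (suc n)
  middle = trans
    (nCk≡nC[n∸k] (subst (suc n ≤_) (sym (split n)) (ℕₚ.m≤n+m (suc n) (suc (suc n)))))
    (cong ((1 + 2 * suc n) C_) (trans (cong (_∸ suc n) (split n)) (ℕₚ.m+n∸n≡m (suc (suc n)) (suc n))))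
  combine : ∀ b x y z → b + x ≡ y → y ≡ z → b + (x + y) ≡ y + z
  combine b x _ _ refl refl = sym (ℕₚ.+-assoc b x (b + x))
ballot-binomial (suc zero)    (suc i) zero (s≤s ())
ballot-binomial (suc (suc e)) (suc i) zero _ = combine (ballot (3 + e) i 1)
  (nC0≡1 (suc i + 2)) (nC1≡n (suc i + 2)) (nC0≡1 (i + 2)) (nC1≡n (i + 2))
  (ballot-binomial (3 + e) i zero (s≤s (s≤s z≤n)))
  where
  combine : ∀ b {x y z u M} → x ≡ 1 → y ≡ suc M → z ≡ 1 → u ≡ M → b + z ≡ u → b + 1 + x ≡ y
  combine b refl refl refl refl refl = ℕₚ.+-comm (b + 1) 1
ballot-binomial (suc e) (suc i) (suc n) (s≤s n<e) =
  combine (ballot (suc (suc e)) i (suc (suc n))) (ballot e (suc (suc i)) (suc n))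
    (nCk+nC[k+1]≡[n+1]C[k+1] (i + 2 * suc (suc n)) n)
    (nCk+nC[k+1]≡[n+1]C[k+1] (i + 2 * suc (suc n)) (suc n))
    (ballot-binomial (suc (suc e)) i (suc n) (s≤s (ℕₚ.m≤n⇒m≤1+n n<e)))
    (subst (λ M → ballot e (suc (suc i)) (suc n) + (M C n) ≡ M C suc n) (reindex i n)
      (ballot-binomial e (suc (suc i)) n n<e))
  where
  reindex : ∀ i n → suc (suc i) + 2 * suc n ≡ i + 2 * suc (suc n)
  reindex = solve-∀
  combine : ∀ b c {x y z u v} → x + y ≡ u → y + z ≡ v → b + y ≡ z → c + x ≡ y → b + c + u ≡ v
  combine b c {x} refl refl refl refl = rearrange b c x
    where
    rearrange : ∀ b c x → b + c + (x + (c + x)) ≡ c + x + (b + (c + x))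
    rearrange = solve-∀

-- With n < e the ceiling is out of reach. For n + 1 up-steps let c be the path number and x, y the
-- binomials C(N,n), C(N,n+1). Reflection gives c = y - x and `absorption` gives (n+1)y = (n+2)x, so
-- (n+2)c = y.
ballot-catalan : ∀ e n → n < e → ballot e 0 n ≡ catalan n
ballot-catalan (suc e) zero    _   = refl
ballot-catalan e       (suc n) n<e = sym (trans (cong (_/ suc (suc n)) central) (m*n/n≡m c (suc (suc n))))
  where
  N = 2 * suc n
  c = ballot e 0 (suc n)
  combine : ∀ c x y → c + x ≡ y → suc n * y + n * x ≡ N * x → y ≡ c * suc (suc n)
  combine c x _ refl eq = ℕₚ.+-cancelʳ-≡ (suc n * (c + x)) (c + x) (c * suc (suc n)) (begin
    (c + x) + suc n * (c + x)              ≡⟨ expand n c x ⟩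
    c * suc (suc n) + suc (suc n) * x      ≡⟨ cong (c * suc (suc n) +_) (ℕₚ.+-cancelʳ-≡ (n * x) _ _ (trans eq (double n x))) ⟨
    c * suc (suc n) + suc n * (c + x)      ∎)
    where
    open ≡-Reasoning
    expand : ∀ n c x → (c + x) + suc n * (c + x) ≡ c * suc (suc n) + suc (suc n) * x
    expand = solve-∀
    double : ∀ n x → 2 * suc n * x ≡ suc (suc n) * x + n * x
    double = solve-∀
  central : N C suc n ≡ c * suc (suc n)
  central = combine c (N C n) (N C suc n) (ballot-binomial e 0 n n<e) (absorption N n)

-- Weights of the states of the generating tree

length-snoc : ∀ (s : List ℕ) y → length (s ++ [ y ]) ≡ suc (length s)
length-snoc s y = trans (length-++ s) (ℕₚ.+-comm (length s) 1)

drop-∷ : ∀ (x : ℕ) s n → n ≤ length s → ∃ λ y → drop n (x ∷ s) ≡ y ∷ drop n s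
drop-∷ x s       zero    _         = x , refl
drop-∷ x (y ∷ s) (suc n) (s≤s len) = drop-∷ y s n len

drop-snoc : ∀ (s : List ℕ) y n → n ≤ length s → drop n (s ++ [ y ]) ≡ drop n s ++ [ y ]
drop-snoc s       y zero    _         = refl
drop-snoc (x ∷ s) y (suc n) (s≤s len) = drop-snoc s y n len

sumFrom : ℕ → ℕ → (ℕ → ℕ) → ℕ
sumFrom lo zero    f = 0
sumFrom lo (suc N) f = f lo + sumFrom (suc lo) N f

sumFrom-cong : ∀ {f g} lo N → (∀ r → r < N + lo → f r ≡ g r) → sumFrom lo N f ≡ sumFrom lo N g
sumFrom-cong lo zero    eq = refl
sumFrom-cong lo (suc N) eq = cong₂ _+_ (eq lo (s≤s (ℕₚ.m≤n+m lo N)))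
  (sumFrom-cong (suc lo) N λ r r< → eq r (subst (r <_) (ℕₚ.+-suc N lo) r<))

sumFrom-suc : ∀ lo N f → sumFrom (suc lo) N f ≡ sumFrom lo N (f ∘ suc)
sumFrom-suc lo zero    f = refl
sumFrom-suc lo (suc N) f = cong (f (suc lo) +_) (sumFrom-suc (suc lo) N f)

sumFrom-+ : ∀ lo N f g → sumFrom lo N (λ r → f r + g r) ≡ sumFrom lo N f + sumFrom lo N g
sumFrom-+ lo zero    f g = refl
sumFrom-+ lo (suc N) f g rewrite sumFrom-+ (suc lo) N f g =
  interchange (f lo) (g lo) (sumFrom (suc lo) N f) (sumFrom (suc lo) N g)

sumFrom-0 : ∀ lo N → sumFrom lo N (λ _ → 0) ≡ 0
sumFrom-0 lo zero    = refl
sumFrom-0 lo (suc N) = sumFrom-0 (suc lo) N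

-- A new letter with j ≥ 1 letters above it keeps the last j entries of the state, so these children
-- are indexed by the nonempty suffixes.
suffixSum : (List ℕ → ℕ) → List ℕ → ℕ
suffixSum F []      = 0
suffixSum F (x ∷ s) = F (x ∷ s) + suffixSum F s

suffixSum-cong : ∀ {F G} → (∀ t → F t ≡ G t) → ∀ s → suffixSum F s ≡ suffixSum G s
suffixSum-cong eq []      = refl
suffixSum-cong eq (x ∷ s) = cong₂ _+_ (eq (x ∷ s)) (suffixSum-cong eq s)

suffixSum-+ : ∀ F G s → suffixSum (λ t → F t + G t) s ≡ suffixSum F s + suffixSum G s
suffixSum-+ F G []      = refl
suffixSum-+ F G (x ∷ s) rewrite suffixSum-+ F G s =
  interchange (F (x ∷ s)) (G (x ∷ s)) (suffixSum F s) (suffixSum G s)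

suffixSum-0 : ∀ s → suffixSum (λ _ → 0) s ≡ 0
suffixSum-0 []      = refl
suffixSum-0 (x ∷ s) = suffixSum-0 s

module Chains (L : ℕ) where

  -- Σ f(rₘ) over the chains lo ≤ r₁ ≤ … ≤ rₘ with rᵢ + xᵢ ≤ L for each entry xᵢ of the list
  -- (and rₘ = lo if the list is empty).
  chainSum : (ℕ → ℕ) → ℕ → List ℕ → ℕ
  chainSum f lo []      = f lo
  chainSum f lo (x ∷ s) = sumFrom lo (suc L ∸ x ∸ lo) (λ r → chainSum f r s)

  private
    range-≤ : ∀ {lo} x → lo ≤ L → suc L ∸ x ∸ lo + lo ≤ suc L
    range-≤ {lo} x lo≤L = ℕₚ.≤-trans
      (ℕₚ.+-monoˡ-≤ lo (ℕₚ.∸-monoˡ-≤ lo (ℕₚ.m∸n≤m (suc L) x)))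
      (ℕₚ.≤-reflexive (ℕₚ.m∸n+n≡m (ℕₚ.m≤n⇒m≤1+n lo≤L)))

  chainSum-cong : ∀ {f g} → (∀ r → r ≤ L → f r ≡ g r) → ∀ {lo} → lo ≤ L → ∀ s → chainSum f lo s ≡ chainSum g lo s
  chainSum-cong eq {lo} lo≤L []      = eq lo lo≤L
  chainSum-cong eq {lo} lo≤L (x ∷ s) = sumFrom-cong lo (suc L ∸ x ∸ lo) λ r r< →
    chainSum-cong eq (ℕ.s≤s⁻¹ (ℕₚ.≤-trans r< (range-≤ x lo≤L))) s

  chainSum-+ : ∀ f g lo s → chainSum (λ r → f r + g r) lo s ≡ chainSum f lo s + chainSum g lo s
  chainSum-+ f g lo []      = refl
  chainSum-+ f g lo (x ∷ s) = trans
    (sumFrom-cong lo (suc L ∸ x ∸ lo) λ r _ → chainSum-+ f g r s)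
    (sumFrom-+ lo (suc L ∸ x ∸ lo) (λ r → chainSum f r s) (λ r → chainSum g r s))

  chainSum-0 : ∀ lo s → chainSum (λ _ → 0) lo s ≡ 0
  chainSum-0 lo []      = refl
  chainSum-0 lo (x ∷ s) = trans (sumFrom-cong lo (suc L ∸ x ∸ lo) λ r _ → chainSum-0 r s)
    (sumFrom-0 lo (suc L ∸ x ∸ lo))

  -- Lowering every term of a chain by one trades a unit of the lower bound for a unit in each
  -- constraint r + x ≤ L.
  chainSum-suc : ∀ f lo s → chainSum f (suc lo) s ≡ chainSum (f ∘ suc) lo (map suc s)
  chainSum-suc f lo []      = refl
  chainSum-suc f lo (x ∷ s) = begin
    sumFrom (suc lo) (suc L ∸ x ∸ suc lo) (λ r → chainSum f r s)
      ≡⟨ sumFrom-suc lo (suc L ∸ x ∸ suc lo) (λ r → chainSum f r s) ⟩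
    sumFrom lo (suc L ∸ x ∸ suc lo) (λ r → chainSum f (suc r) s)
      ≡⟨ cong (λ N → sumFrom lo N (λ r → chainSum f (suc r) s)) range ⟩
    sumFrom lo (L ∸ x ∸ lo) (λ r → chainSum f (suc r) s)
      ≡⟨ sumFrom-cong lo (L ∸ x ∸ lo) (λ r _ → chainSum-suc f r s) ⟩
    sumFrom lo (L ∸ x ∸ lo) (λ r → chainSum (f ∘ suc) r (map suc s)) ∎
    where
    open ≡-Reasoning
    range : suc L ∸ x ∸ suc lo ≡ L ∸ x ∸ lo
    range = begin
      suc L ∸ x ∸ suc lo   ≡⟨ ℕₚ.∸-+-assoc (suc L) x (suc lo) ⟩
      suc L ∸ (x + suc lo) ≡⟨ cong (suc L ∸_) (ℕₚ.+-suc x lo) ⟩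
      L ∸ (x + lo)         ≡⟨ ℕₚ.∸-+-assoc L x lo ⟨
      L ∸ x ∸ lo           ∎

  -- A final entry 0 asks of the last term only that it be at most L, so the sum over that term can
  -- be absorbed into f.
  chainSum-snoc-0 : ∀ f lo s →
    chainSum f lo (s ++ [ 0 ]) ≡ chainSum (λ r → sumFrom r (suc L ∸ r) f) lo s
  chainSum-snoc-0 f lo []      = refl
  chainSum-snoc-0 f lo (x ∷ s) = sumFrom-cong lo (suc L ∸ x ∸ lo) λ r _ → chainSum-snoc-0 f r s

  chainSum-exceeds : ∀ f lo {s} → Any (L <_) s → chainSum f lo s ≡ 0
  chainSum-exceeds f lo {x ∷ s} (here L<x) rewrite ℕₚ.m≤n⇒m∸n≡0 L<x | ℕₚ.0∸n≡0 lo = refl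
  chainSum-exceeds f lo {x ∷ s} (there ex) = trans
    (sumFrom-cong lo (suc L ∸ x ∸ lo) λ r _ → chainSum-exceeds f r ex)
    (sumFrom-0 lo (suc L ∸ x ∸ lo))

  -- Chains starting at 0 are classified by their number of leading zeros.
  chainSum-leading-zeros : ∀ f {s} → All (_≤ L) s →
    chainSum f 0 s ≡ f 0 + suffixSum (λ t → chainSum (f ∘ suc) 0 (map suc t)) s
  chainSum-leading-zeros f []                      = sym (ℕₚ.+-identityʳ (f 0))
  chainSum-leading-zeros f {x ∷ s} (x≤L ∷ s≤L)
    rewrite ℕₚ.+-∸-assoc 1 x≤L = begin
    chainSum f 0 s + sumFrom 1 (L ∸ x) (λ r → chainSum f r s)
      ≡⟨ cong₂ _+_ (chainSum-leading-zeros f s≤L) first-positive ⟩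
    f 0 + rest + chainSum (f ∘ suc) 0 (map suc (x ∷ s))
      ≡⟨ rearrange (f 0) rest _ ⟩
    f 0 + (chainSum (f ∘ suc) 0 (map suc (x ∷ s)) + rest) ∎
    where
    open ≡-Reasoning
    rest = suffixSum (λ t → chainSum (f ∘ suc) 0 (map suc t)) s
    rearrange : ∀ a b c → a + b + c ≡ a + (c + b)
    rearrange = solve-∀
    first-positive : sumFrom 1 (L ∸ x) (λ r → chainSum f r s) ≡ chainSum (f ∘ suc) 0 (map suc (x ∷ s))
    first-positive = trans
      (cong (λ N → sumFrom 1 N (λ r → chainSum f r s)) (sym (cong (_∸ 1) (ℕₚ.+-∸-assoc 1 x≤L))))
      (chainSum-suc f 0 (x ∷ s))

-- [n ≥ r] · ballot (e ∸ r) (i + r) (n ∸ r)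
delayedBallot : ℕ → ℕ → ℕ → ℕ → ℕ
delayedBallot e       i n       zero    = ballot e i n
delayedBallot zero    i n       (suc r) = 0
delayedBallot (suc e) i zero    (suc r) = 0
delayedBallot (suc e) i (suc n) (suc r) = delayedBallot e (suc i) n r

delayedBallot-ceiling : ∀ e i n → delayedBallot e i n e ≡ 0
delayedBallot-ceiling zero    i n       = refl
delayedBallot-ceiling (suc e) i zero    = refl
delayedBallot-ceiling (suc e) i (suc n) = delayedBallot-ceiling e (suc i) n

-- `delayedBallot e i n r` counts the paths that begin with r up-steps. After r + 1 of them the path
-- either rises again, or falls; in the second case deleting the peak leaves a path with r initial
-- up-steps. The hypothesis says that the peak fits below the ceiling.
delayedBallot-recurrence : ∀ e i n r → 2 + r ≤ e →
  delayedBallot e i (suc n) (suc r) ≡ delayedBallot e i (suc n) (2 + r) + delayedBallot e i n r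
delayedBallot-recurrence (suc zero) i n r (s≤s ())
delayedBallot-recurrence (suc (suc e)) i zero    zero    _ = refl
delayedBallot-recurrence (suc (suc e)) i (suc n) zero    _ =
  ℕₚ.+-comm (ballot (suc (suc e)) i (suc n)) (ballot e (suc (suc i)) n)
delayedBallot-recurrence (suc (suc e)) i zero    (suc r) _ = refl
delayedBallot-recurrence (suc (suc e)) i (suc n) (suc r) (s≤s 2+r≤e) =
  delayedBallot-recurrence (suc e) (suc i) n r 2+r≤e

-- The recurrence telescopes up to r = L; the leftover term has 2 + L initial up-steps and vanishes
-- at the ceiling.
delayedBallot-tail : ∀ L i n r N → N + r ≡ suc L →
  sumFrom r N (delayedBallot (2 + L) i n) ≡ delayedBallot (2 + L) i (suc n) (suc r)
delayedBallot-tail L i n r zero    refl = sym (delayedBallot-ceiling (2 + L) i (suc n))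
delayedBallot-tail L i n r (suc N) eq   = begin
  delayedBallot (2 + L) i n r + sumFrom (suc r) N (delayedBallot (2 + L) i n)
    ≡⟨ cong (delayedBallot (2 + L) i n r +_) (delayedBallot-tail L i n (suc r) N (trans (ℕₚ.+-suc N r) eq)) ⟩
  delayedBallot (2 + L) i n r + delayedBallot (2 + L) i (suc n) (2 + r)
    ≡⟨ ℕₚ.+-comm (delayedBallot (2 + L) i n r) _ ⟩
  delayedBallot (2 + L) i (suc n) (2 + r) + delayedBallot (2 + L) i n r
    ≡⟨ delayedBallot-recurrence (2 + L) i n r (s≤s (subst (suc r ≤_) eq (s≤s (ℕₚ.m≤n+m r N)))) ⟨
  delayedBallot (2 + L) i (suc n) (suc r) ∎
  where open ≡-Reasoning

ballotFromBelow : ℕ → ℕ → ℕ → ℕ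
ballotFromBelow k n zero    = 0
ballotFromBelow k n (suc i) = ballot (k ∸ i) i (suc n)

-- The first step of a path, with the ceiling k held fixed in place of the room above the path; a
-- step down from the floor counts as 0.
ballot-step : ∀ k n i → i < k → ballot (k ∸ i) i (suc n) ≡ ballot (k ∸ suc i) (suc i) n + ballotFromBelow k n i
ballot-step (suc k) n zero    _         = sym (ℕₚ.+-identityʳ _)
ballot-step (suc (suc k)) n (suc i) (s≤s (s≤s i≤k))
  rewrite ℕₚ.+-∸-assoc 2 i≤k | ℕₚ.+-∸-assoc 1 i≤k = ℕₚ.+-comm (ballot (2 + (k ∸ i)) i (suc n)) _

module Weights (S L : ℕ) where
  open Chains L

  ceiling : ℕ
  ceiling = S + suc (suc L)

  ceiling∸S : ceiling ∸ S ≡ 2 + L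
  ceiling∸S = ℕₚ.m+n∸m≡n S (2 + L)

  short<ceiling : ∀ {i} → i ≤ S → i < ceiling
  short<ceiling i≤S = ℕₚ.≤-trans (s≤s i≤S) (subst (suc S ≤_) (sym (ℕₚ.+-suc S (suc L))) (s≤s (ℕₚ.m≤m+n S (suc L))))

  longWeight : ℕ → List ℕ → ℕ
  longWeight n = chainSum (delayedBallot (2 + L) S n) 0

  -- The number of n-step continuations in the generating tree of a permutation with state s. The
  -- first S entries of s never matter, except through their number when there are no others.
  weight : ℕ → List ℕ → ℕ
  weight n s with length s ≤? S
  ... | yes _ = ballot (ceiling ∸ length s) (length s) n
  ... | no  _ = longWeight n (drop S s)

  weight-short : ∀ n s → length s ≤ S → weight n s ≡ ballot (ceiling ∸ length s) (length s) n
  weight-short n s len with length s ≤? S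
  ... | yes _  = refl
  ... | no len≰ = contradiction len len≰

  -- At length S the chain is empty and both clauses of `weight` agree, so the long formula extends
  -- to that length.
  weight-long : ∀ n s → S ≤ length s → weight n s ≡ longWeight n (drop S s)
  weight-long n s len with length s ≤? S
  ... | no  _    = refl
  ... | yes len≤ rewrite drop-all S s len≤ | ℕₚ.≤-antisym len≤ len | ceiling∸S = refl

  weight-exceeds : ∀ n s → Any (L <_) (drop S s) → weight n s ≡ 0
  weight-exceeds n s ex with length s ≤? S
  ... | no  _    = chainSum-exceeds (delayedBallot (2 + L) S n) 0 ex
  ... | yes len≤ with drop S s | drop-all S s len≤
  weight-exceeds n s () | yes _ | [] | refl

  -- With no up-step left only the chain of zeros contributes, and entries at most L permit it.
  weight-0 : ∀ s → All (_≤ L) (drop S s) → weight 0 s ≡ 1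
  weight-0 s s≤L with length s ≤? S
  ... | yes len≤ rewrite ℕₚ.+-suc S (suc L) | ℕₚ.+-∸-assoc 1 (ℕₚ.≤-trans len≤ (ℕₚ.m≤m+n S (suc L))) = refl
  ... | no  _    = begin
    longWeight 0 (drop S s)
      ≡⟨ chainSum-leading-zeros (delayedBallot (2 + L) S 0) s≤L ⟩
    1 + suffixSum (λ t → chainSum (λ _ → 0) 0 (map suc t)) (drop S s)
      ≡⟨ cong suc (suffixSum-cong (λ t → chainSum-0 0 (map suc t)) (drop S s)) ⟩
    1 + suffixSum (λ _ → 0) (drop S s)
      ≡⟨ cong suc (suffixSum-0 (drop S s)) ⟩
    1 ∎
    where open ≡-Reasoning

  successors : ℕ → List ℕ → ℕ
  successors n = suffixSum (λ t → weight n (map suc t))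

  -- A path from height `length s` - 1 falls for a while and then rises; the height reached by that
  -- first up-step is the length of the suffix. `ballot-step` telescopes over it.
  successors-short : ∀ n s → length s ≤ S → successors n s ≡ ballotFromBelow ceiling n (length s)
  successors-short n []      _   = refl
  successors-short n (x ∷ s) len = begin
    weight n (map suc (x ∷ s)) + successors n s
      ≡⟨ cong₂ _+_ (weight-short n (map suc (x ∷ s)) (subst (_≤ S) (sym (cong suc (length-map suc s))) len))
                   (successors-short n s (ℕₚ.<⇒≤ len)) ⟩
    ballot (ceiling ∸ suc (length (map suc s))) (suc (length (map suc s))) n + ballotFromBelow ceiling n (length s)
      ≡⟨ cong (λ l → ballot (ceiling ∸ suc l) (suc l) n + ballotFromBelow ceiling n (length s)) (length-map suc s) ⟩
    ballot (ceiling ∸ suc (length s)) (suc (length s)) n + ballotFromBelow ceiling n (length s)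
      ≡⟨ ballot-step ceiling n (length s) (short<ceiling (ℕₚ.<⇒≤ len)) ⟨
    ballot (ceiling ∸ length s) (length s) (suc n) ∎
    where open ≡-Reasoning

  successors-long : ∀ n s → S ≤ length s → successors n s ≡
    ballotFromBelow ceiling n S + suffixSum (λ t → longWeight n (map suc t)) (drop S s)
  successors-long n s len with length s ≤? S
  ... | yes len≤ rewrite drop-all S s len≤ = trans (successors-short n s len≤)
    (trans (cong (ballotFromBelow ceiling n) (ℕₚ.≤-antisym len≤ len)) (sym (ℕₚ.+-identityʳ _)))
  successors-long n []      len | no len≰ = contradiction z≤n len≰
  successors-long n (x ∷ s) len | no len≰ with drop-∷ x s S (ℕ.s≤s⁻¹ (ℕₚ.≰⇒> len≰))
  ... | y , eq rewrite eq = begin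
    weight n (map suc (x ∷ s)) + successors n s
      ≡⟨ cong₂ _+_ first (successors-long n s len′) ⟩
    longWeight n (map suc (y ∷ drop S s)) + (ballotFromBelow ceiling n S + rest)
      ≡⟨ rearrange (longWeight n (map suc (y ∷ drop S s))) (ballotFromBelow ceiling n S) rest ⟩
    ballotFromBelow ceiling n S + (longWeight n (map suc (y ∷ drop S s)) + rest) ∎
    where
    open ≡-Reasoning
    len′ : S ≤ length s
    len′ = ℕ.s≤s⁻¹ (ℕₚ.≰⇒> len≰)
    rest = suffixSum (λ t → longWeight n (map suc t)) (drop S s)
    rearrange : ∀ a b c → a + (b + c) ≡ b + (a + c)
    rearrange = solve-∀
    first : weight n (map suc (x ∷ s)) ≡ longWeight n (map suc (y ∷ drop S s))
    first = trans
      (weight-long n (map suc (x ∷ s)) (subst (S ≤_) (sym (length-map suc (x ∷ s))) len))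
      (cong (longWeight n) (trans (drop-map S (x ∷ s)) (cong (map suc) eq)))

  -- The branching rule of the tree. For a short state it is the first step of a path. For a long
  -- one, chains are split by their leading zeros, then the zero term by `ballot-step` and the
  -- others by the peak recurrence. The first halves reassemble into the chains of s ++ [ 0 ], the
  -- second halves into the remaining children.
  weight-suc : ∀ n s → All (_≤ L) (drop S s) →
    weight (suc n) s ≡ weight n (s ++ [ 0 ]) + successors n s
  weight-suc n s s≤L with ℕₚ.<-≤-connex (length s) S
  ... | inj₁ len<S = begin
    weight (suc n) s
      ≡⟨ weight-short (suc n) s (ℕₚ.<⇒≤ len<S) ⟩
    ballot (ceiling ∸ length s) (length s) (suc n)
      ≡⟨ ballot-step ceiling n (length s) (short<ceiling (ℕₚ.<⇒≤ len<S)) ⟩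
    ballot (ceiling ∸ suc (length s)) (suc (length s)) n + ballotFromBelow ceiling n (length s)
      ≡⟨ cong₂ _+_ (trans (weight-short n (s ++ [ 0 ]) (subst (_≤ S) (sym (length-snoc s 0)) len<S))
                          (cong (λ l → ballot (ceiling ∸ l) l n) (length-snoc s 0)))
                   (successors-short n s (ℕₚ.<⇒≤ len<S)) ⟨
    weight n (s ++ [ 0 ]) + successors n s ∎
    where open ≡-Reasoning
  ... | inj₂ S≤len = begin
    weight (suc n) s
      ≡⟨ weight-long (suc n) s S≤len ⟩
    chainSum g 0 d
      ≡⟨ chainSum-leading-zeros g s≤L ⟩
    ballot (2 + L) S (suc n) + suffixSum (λ t → chainSum (g ∘ suc) 0 (map suc t)) d
      ≡⟨ cong₂ _+_ at-zero (trans (suffixSum-cong at-suc d) (suffixSum-+ _ _ d)) ⟩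
    (ballot (1 + L) (suc S) n + ballotFromBelow ceiling n S) +
    (suffixSum (λ t → chainSum (g ∘ suc ∘ suc) 0 (map suc t)) d + suffixSum (λ t → longWeight n (map suc t)) d)
      ≡⟨ interchange (ballot (1 + L) (suc S) n) _ _ _ ⟩
    (ballot (1 + L) (suc S) n + suffixSum (λ t → chainSum (g ∘ suc ∘ suc) 0 (map suc t)) d) +
    (ballotFromBelow ceiling n S + suffixSum (λ t → longWeight n (map suc t)) d)
      ≡⟨ cong₂ _+_ (trans prepend-zero (chainSum-leading-zeros (g ∘ suc) s≤L)) (successors-long n s S≤len) ⟨
    weight n (s ++ [ 0 ]) + successors n s ∎
    where
    open ≡-Reasoning
    d = drop S s
    g = delayedBallot (2 + L) S (suc n)
    at-zero : ballot (2 + L) S (suc n) ≡ ballot (1 + L) (suc S) n + ballotFromBelow ceiling n S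
    at-zero = subst₂ (λ a b → ballot a S (suc n) ≡ ballot b (suc S) n + ballotFromBelow ceiling n S)
      ceiling∸S (trans (sym (ℕₚ.pred[m∸n]≡m∸[1+n] ceiling S)) (cong ℕ.pred ceiling∸S)) (ballot-step ceiling n S (short<ceiling ℕₚ.≤-refl))
    at-suc : ∀ t → chainSum (g ∘ suc) 0 (map suc t) ≡ chainSum (g ∘ suc ∘ suc) 0 (map suc t) + longWeight n (map suc t)
    at-suc t = trans
      (chainSum-cong (λ r r≤L → delayedBallot-recurrence (2 + L) S n r (s≤s (s≤s r≤L))) z≤n (map suc t))
      (chainSum-+ (g ∘ suc ∘ suc) (delayedBallot (2 + L) S n) 0 (map suc t))
    prepend-zero : weight n (s ++ [ 0 ]) ≡ chainSum (g ∘ suc) 0 d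
    prepend-zero = begin
      weight n (s ++ [ 0 ])
        ≡⟨ weight-long n (s ++ [ 0 ]) (subst (S ≤_) (sym (length-snoc s 0)) (ℕₚ.m≤n⇒m≤1+n S≤len)) ⟩
      longWeight n (drop S (s ++ [ 0 ]))
        ≡⟨ cong (longWeight n) (drop-snoc s 0 S S≤len) ⟩
      longWeight n (d ++ [ 0 ])
        ≡⟨ chainSum-snoc-0 (delayedBallot (2 + L) S n) 0 d ⟩
      chainSum (λ r → sumFrom r (suc L ∸ r) (delayedBallot (2 + L) S n)) 0 d
        ≡⟨ chainSum-cong (λ r r≤L → delayedBallot-tail L S n r (suc L ∸ r) (ℕₚ.m∸n+n≡m (ℕₚ.m≤n⇒m≤1+n r≤L))) z≤n d ⟩
      chainSum (g ∘ suc) 0 d ∎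

-- Permutations by first letter

punchIn : ℕ → ℕ → ℕ
punchIn zero    x       = suc x
punchIn (suc a) zero    = zero
punchIn (suc a) (suc x) = suc (punchIn a x)

punchIn-≡ᵇ : ∀ a x y → (punchIn a x ≡ᵇ punchIn a y) ≡ (x ≡ᵇ y)
punchIn-≡ᵇ zero    x       y       = refl
punchIn-≡ᵇ (suc a) zero    zero    = refl
punchIn-≡ᵇ (suc a) zero    (suc y) = refl
punchIn-≡ᵇ (suc a) (suc x) zero    = refl
punchIn-≡ᵇ (suc a) (suc x) (suc y) = punchIn-≡ᵇ a x y

punchIn-<ᵇ : ∀ a x y → (punchIn a x <ᵇ punchIn a y) ≡ (x <ᵇ y)
punchIn-<ᵇ zero    x       y       = refl
punchIn-<ᵇ (suc a) zero    zero    = refl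
punchIn-<ᵇ (suc a) zero    (suc y) = refl
punchIn-<ᵇ (suc a) (suc x) zero    = refl
punchIn-<ᵇ (suc a) (suc x) (suc y) = punchIn-<ᵇ a x y

_≢ᵇ_ : ℕ → ℕ → Bool
x ≢ᵇ y = if x ≡ᵇ y then false else true

module _ {A : Set} where

  filterᵇ-map : ∀ {B : Set} (p : B → Bool) (f : A → B) xs → filterᵇ p (map f xs) ≡ map f (filterᵇ (p ∘ f) xs)
  filterᵇ-map p f []       = refl
  filterᵇ-map p f (x ∷ xs) with p (f x)
  ... | true  = cong (f x ∷_) (filterᵇ-map p f xs)
  ... | false = filterᵇ-map p f xs

  filterᵇ-cong : ∀ {p q : A → Bool} {xs} → All (λ x → p x ≡ q x) xs → filterᵇ p xs ≡ filterᵇ q xs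
  filterᵇ-cong []       = refl
  filterᵇ-cong {p} {q} {x ∷ xs} (eq ∷ eqs) with p x | q x | eq
  ... | true  | _ | refl = cong (x ∷_) (filterᵇ-cong eqs)
  ... | false | _ | refl = filterᵇ-cong eqs

  filterᵇ-concatMap : ∀ {B : Set} (p : B → Bool) (f : A → List B) xs →
    filterᵇ p (concatMap f xs) ≡ concatMap (filterᵇ p ∘ f) xs
  filterᵇ-concatMap p f []       = refl
  filterᵇ-concatMap p f (x ∷ xs) =
    trans (filter-++ (T? ∘ p) (f x) (concatMap f xs)) (cong (filterᵇ p (f x) ++_) (filterᵇ-concatMap p f xs))

  filterᵇ-∧ : ∀ (p q : A → Bool) xs → filterᵇ (λ x → p x ∧ q x) xs ≡ filterᵇ q (filterᵇ p xs)
  filterᵇ-∧ p q []       = refl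
  filterᵇ-∧ p q (x ∷ xs) with p x
  ... | false = filterᵇ-∧ p q xs
  ... | true with q x
  ... | true  = cong (x ∷_) (filterᵇ-∧ p q xs)
  ... | false = filterᵇ-∧ p q xs

  filterᵇ-const-∧ : ∀ b (p : A → Bool) xs → filterᵇ (λ x → b ∧ p x) xs ≡ (if b then filterᵇ p xs else [])
  filterᵇ-const-∧ true  p xs       = refl
  filterᵇ-const-∧ false p []       = refl
  filterᵇ-const-∧ false p (x ∷ xs) = filterᵇ-const-∧ false p xs

  concatMap-if : ∀ {B : Set} (p : A → Bool) (f : A → List B) xs →
    concatMap (λ x → if p x then f x else []) xs ≡ concatMap f (filterᵇ p xs)
  concatMap-if p f []       = refl
  concatMap-if p f (x ∷ xs) with p x
  ... | true  = cong (f x ++_) (concatMap-if p f xs)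
  ... | false = concatMap-if p f xs

upTo-without : ∀ a n → a ≤ n → filterᵇ (a ≢ᵇ_) (upTo (suc n)) ≡ map (punchIn a) (upTo n)
upTo-without zero n _ = trans (cong (filterᵇ (0 ≢ᵇ_)) (sym (map-upTo suc n))) (all-positive (upTo n))
  where
  all-positive : ∀ xs → filterᵇ (0 ≢ᵇ_) (map suc xs) ≡ map suc xs
  all-positive []       = refl
  all-positive (x ∷ xs) = cong (suc x ∷_) (all-positive xs)
upTo-without (suc a) (suc n) (s≤s a≤n) = cong (0 ∷_) (begin
  filterᵇ (suc a ≢ᵇ_) (applyUpTo suc (suc n))          ≡⟨ cong (filterᵇ (suc a ≢ᵇ_)) (map-upTo suc (suc n)) ⟨
  filterᵇ (suc a ≢ᵇ_) (map suc (upTo (suc n)))         ≡⟨ filterᵇ-map (suc a ≢ᵇ_) suc (upTo (suc n)) ⟩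
  map suc (filterᵇ (a ≢ᵇ_) (upTo (suc n)))             ≡⟨ cong (map suc) (upTo-without a n a≤n) ⟩
  map suc (map (punchIn a) (upTo n))                   ≡⟨ map-∘ (upTo n) ⟨
  map (punchIn (suc a) ∘ suc) (upTo n)                 ≡⟨ map-∘ (upTo n) ⟩
  map (punchIn (suc a)) (map suc (upTo n))             ≡⟨ cong (map (punchIn (suc a))) (map-upTo suc n) ⟩
  map (punchIn (suc a)) (applyUpTo suc n)              ∎)
  where open ≡-Reasoning

words-without : ∀ a n m → a ≤ n → filterᵇ (all (a ≢ᵇ_)) (words (suc n) m) ≡ map (map (punchIn a)) (words n m)
words-without a n zero    a≤n = refl
words-without a n (suc m) a≤n = begin
  filterᵇ (all (a ≢ᵇ_)) (concatMap (λ b → map (b ∷_) (words (suc n) m)) (upTo (suc n)))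
    ≡⟨ filterᵇ-concatMap (all (a ≢ᵇ_)) (λ b → map (b ∷_) (words (suc n) m)) (upTo (suc n)) ⟩
  concatMap (λ b → filterᵇ (all (a ≢ᵇ_)) (map (b ∷_) (words (suc n) m))) (upTo (suc n))
    ≡⟨ concatMap-cong each (upTo (suc n)) ⟩
  concatMap (λ b → if a ≢ᵇ b then map (b ∷_) punched else []) (upTo (suc n))
    ≡⟨ concatMap-if (a ≢ᵇ_) (λ b → map (b ∷_) punched) (upTo (suc n)) ⟩
  concatMap (λ b → map (b ∷_) punched) (filterᵇ (a ≢ᵇ_) (upTo (suc n)))
    ≡⟨ cong (concatMap (λ b → map (b ∷_) punched)) (upTo-without a n a≤n) ⟩
  concatMap (λ b → map (b ∷_) punched) (map (punchIn a) (upTo n))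
    ≡⟨ concatMap-map (λ b → map (b ∷_) punched) (punchIn a) (upTo n) ⟩
  concatMap (λ b → map (punchIn a b ∷_) punched) (upTo n)
    ≡⟨ concatMap-cong (λ b → trans (sym (map-∘ (words n m))) (map-∘ (words n m))) (upTo n) ⟩
  concatMap (λ b → map (map (punchIn a)) (map (b ∷_) (words n m))) (upTo n)
    ≡⟨ map-concatMap (map (punchIn a)) (λ b → map (b ∷_) (words n m)) (upTo n) ⟨
  map (map (punchIn a)) (concatMap (λ b → map (b ∷_) (words n m)) (upTo n)) ∎
  where
  open ≡-Reasoning
  punched = map (map (punchIn a)) (words n m)
  push-if : ∀ b c (xs : List (List ℕ)) → map (b ∷_) (if c then xs else []) ≡ (if c then map (b ∷_) xs else [])
  push-if b true  xs = refl
  push-if b false xs = refl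
  each : ∀ b → filterᵇ (all (a ≢ᵇ_)) (map (b ∷_) (words (suc n) m)) ≡ (if a ≢ᵇ b then map (b ∷_) punched else [])
  each b = begin
    filterᵇ (all (a ≢ᵇ_)) (map (b ∷_) (words (suc n) m))
      ≡⟨ filterᵇ-map (all (a ≢ᵇ_)) (b ∷_) (words (suc n) m) ⟩
    map (b ∷_) (filterᵇ (λ v → (a ≢ᵇ b) ∧ all (a ≢ᵇ_) v) (words (suc n) m))
      ≡⟨ cong (map (b ∷_)) (filterᵇ-const-∧ (a ≢ᵇ b) (all (a ≢ᵇ_)) (words (suc n) m)) ⟩
    map (b ∷_) (if a ≢ᵇ b then filterᵇ (all (a ≢ᵇ_)) (words (suc n) m) else [])
      ≡⟨ cong (λ xs → map (b ∷_) (if a ≢ᵇ b then xs else [])) (words-without a n m a≤n) ⟩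
    map (b ∷_) (if a ≢ᵇ b then punched else [])
      ≡⟨ push-if b (a ≢ᵇ b) punched ⟩
    (if a ≢ᵇ b then map (b ∷_) punched else []) ∎

distinctᵇ-punchIn : ∀ a v → distinctᵇ (map (punchIn a) v) ≡ distinctᵇ v
distinctᵇ-punchIn a []      = refl
distinctᵇ-punchIn a (x ∷ v) = cong₂ _∧_ (fresh v) (distinctᵇ-punchIn a v)
  where
  fresh : ∀ v → all (punchIn a x ≢ᵇ_) (map (punchIn a) v) ≡ all (x ≢ᵇ_) v
  fresh []      = refl
  fresh (y ∷ v) = cong₂ _∧_ (cong (λ b → if b then false else true) (punchIn-≡ᵇ a x y)) (fresh v)

prepend : ℕ → List ℕ → List ℕ
prepend a v = a ∷ map (punchIn a) v

concatMap-upTo-cong : ∀ {A : Set} {f g : ℕ → List A} n → (∀ a → a < n → f a ≡ g a) → concatMap f (upTo n) ≡ concatMap g (upTo n)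
concatMap-upTo-cong zero    eq = refl
concatMap-upTo-cong {f = f} {g} (suc n) eq = cong₂ _++_ (eq 0 (s≤s z≤n)) (begin
  concatMap f (applyUpTo suc n)        ≡⟨ cong (concatMap f) (map-upTo suc n) ⟨
  concatMap f (map suc (upTo n))       ≡⟨ concatMap-map f suc (upTo n) ⟩
  concatMap (f ∘ suc) (upTo n)         ≡⟨ concatMap-upTo-cong n (λ a a<n → eq (suc a) (s≤s a<n)) ⟩
  concatMap (g ∘ suc) (upTo n)         ≡⟨ concatMap-map g suc (upTo n) ⟨
  concatMap g (map suc (upTo n))       ≡⟨ cong (concatMap g) (map-upTo suc n) ⟩
  concatMap g (applyUpTo suc n)        ∎)
  where open ≡-Reasoning

perms-suc : ∀ n → perms (suc n) ≡ concatMap (λ a → map (prepend a) (perms n)) (upTo (suc n))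
perms-suc n = trans
  (filterᵇ-concatMap distinctᵇ (λ a → map (a ∷_) (words (suc n) n)) (upTo (suc n)))
  (concatMap-upTo-cong (suc n) λ a a≤n → begin
    filterᵇ distinctᵇ (map (a ∷_) (words (suc n) n))
      ≡⟨ filterᵇ-map distinctᵇ (a ∷_) (words (suc n) n) ⟩
    map (a ∷_) (filterᵇ (λ v → all (a ≢ᵇ_) v ∧ distinctᵇ v) (words (suc n) n))
      ≡⟨ cong (map (a ∷_)) (filterᵇ-∧ (all (a ≢ᵇ_)) distinctᵇ (words (suc n) n)) ⟩
    map (a ∷_) (filterᵇ distinctᵇ (filterᵇ (all (a ≢ᵇ_)) (words (suc n) n)))
      ≡⟨ cong (λ ws → map (a ∷_) (filterᵇ distinctᵇ ws)) (words-without a n n (ℕ.s≤s⁻¹ a≤n)) ⟩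
    map (a ∷_) (filterᵇ distinctᵇ (map (map (punchIn a)) (words n n)))
      ≡⟨ cong (map (a ∷_)) (filterᵇ-map distinctᵇ (map (punchIn a)) (words n n)) ⟩
    map (a ∷_) (map (map (punchIn a)) (filterᵇ (distinctᵇ ∘ map (punchIn a)) (words n n)))
      ≡⟨ cong (λ vs → map (a ∷_) (map (map (punchIn a)) vs)) (filterᵇ-cong (All.universal (distinctᵇ-punchIn a) (words n n))) ⟩
    map (a ∷_) (map (map (punchIn a)) (perms n))
      ≡⟨ map-∘ (perms n) ⟨
    map (prepend a) (perms n) ∎)
  where open ≡-Reasoning

above : ℕ → List ℕ → ℕ
above a []      = 0
above a (x ∷ v) = if a <ᵇ x then suc (above a v) else above a v

lastN : ℕ → List ℕ → List ℕ
lastN j s = drop (length s ∸ j) s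

-- Here j counts the letters above the new first letter a. If j = 0, then a is the new maximum and
-- has nothing in front. Otherwise a precedes every letter above it, so the decreasing run of top
-- values stops just above a, and a is one more smaller letter in front of each.
advance : ℕ → List ℕ → List ℕ
advance zero    s = s ++ [ 0 ]
advance (suc j) s = map suc (lastN (suc j) s)

-- For a 123-avoiding v: take the largest values of v for as long as they occur in decreasing
-- order. For each of them, from the last (smallest) to the first (largest), state v records
-- the number of smaller letters in front of it.
state : List ℕ → List ℕ
state []      = []
state (a ∷ v) = advance (above a v) (state v)

lastN-0 : ∀ s → lastN 0 s ≡ []
lastN-0 s = drop-all (length s) s ℕₚ.≤-refl

lastN-++ : ∀ u t → lastN (length t) (u ++ t) ≡ t
lastN-++ u t rewrite length-++ u {t} | ℕₚ.m+n∸n≡m (length u) (length t) = drop-prefix u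
  where
  drop-prefix : ∀ u → drop (length u) (u ++ t) ≡ t
  drop-prefix []      = refl
  drop-prefix (x ∷ u) = drop-prefix u

length-lastN : ∀ j s → length (lastN j s) ≤ length s
length-lastN j s = subst (_≤ length s) (sym (length-drop (length s ∸ j) s)) (ℕₚ.m∸n≤m (length s) (length s ∸ j))

length-state : ∀ v → length (state v) ≤ length v
length-state []      = z≤n
length-state (a ∷ v) with above a v
... | zero  = subst (_≤ suc (length v)) (sym (trans (length-++ (state v)) (ℕₚ.+-comm (length (state v)) 1))) (s≤s (length-state v))
... | suc j = subst (_≤ suc (length v)) (sym (length-map suc (lastN (suc j) (state v))))
  (ℕₚ.m≤n⇒m≤1+n (ℕₚ.≤-trans (length-lastN (suc j) (state v)) (length-state v)))

above-punchIn : ∀ a x v → above (punchIn a x) (map (punchIn a) v) ≡ above x v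
above-punchIn a x []      = refl
above-punchIn a x (y ∷ v) rewrite punchIn-<ᵇ a x y | above-punchIn a x v = refl

state-punchIn : ∀ a v → state (map (punchIn a) v) ≡ state v
state-punchIn a []      = refl
state-punchIn a (x ∷ v) = cong₂ advance (above-punchIn a x v) (state-punchIn a v)

atLeast : ℕ → List ℕ → ℕ
atLeast a []      = 0
atLeast a (x ∷ v) = if a <ᵇ suc x then suc (atLeast a v) else atLeast a v

<ᵇ-punchIn : ∀ a x → (a <ᵇ punchIn a x) ≡ (a <ᵇ suc x)
<ᵇ-punchIn zero    x       = refl
<ᵇ-punchIn (suc a) zero    = refl
<ᵇ-punchIn (suc a) (suc x) = <ᵇ-punchIn a x

above-prepend : ∀ a v → above a (map (punchIn a) v) ≡ atLeast a v
above-prepend a []      = refl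
above-prepend a (x ∷ v) rewrite <ᵇ-punchIn a x | above-prepend a v = refl

<ᵇ-punchIn-≤ : ∀ {a b} → a ≤ b → ∀ x → (a <ᵇ suc (punchIn b x)) ≡ (a <ᵇ suc x)
<ᵇ-punchIn-≤ z≤n       x       = refl
<ᵇ-punchIn-≤ (s≤s a≤b) zero    = refl
<ᵇ-punchIn-≤ (s≤s a≤b) (suc x) = <ᵇ-punchIn-≤ a≤b x

atLeast-punchIn-≤ : ∀ {a b} → a ≤ b → ∀ v → atLeast a (map (punchIn b) v) ≡ atLeast a v
atLeast-punchIn-≤ a≤b []      = refl
atLeast-punchIn-≤ {a} {b} a≤b (x ∷ v) rewrite <ᵇ-punchIn-≤ a≤b x | atLeast-punchIn-≤ a≤b v = refl

<ᵇ-punchIn-> : ∀ {a b} → b ≤ a → ∀ x → (suc a <ᵇ suc (punchIn b x)) ≡ (a <ᵇ suc x)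
<ᵇ-punchIn-> z≤n       x       = refl
<ᵇ-punchIn-> (s≤s b≤a) zero    = refl
<ᵇ-punchIn-> (s≤s b≤a) (suc x) = <ᵇ-punchIn-> b≤a x

atLeast-punchIn-> : ∀ {a b} → b ≤ a → ∀ v → atLeast (suc a) (map (punchIn b) v) ≡ atLeast a v
atLeast-punchIn-> b≤a []      = refl
atLeast-punchIn-> {a} {b} b≤a (x ∷ v) rewrite <ᵇ-punchIn-> b≤a x | atLeast-punchIn-> b≤a v = refl

All-concatMap-upTo : ∀ {A : Set} {P : A → Set} (f : ℕ → List A) n → (∀ a → a < n → All P (f a)) → All P (concatMap f (upTo n))
All-concatMap-upTo f n all = Allₚ.concat⁺ (Allₚ.map⁺ (Allₚ.applyUpTo⁺₁ (λ a → a) n (λ {a} → all a)))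

perms-length : ∀ n → All (λ v → length v ≡ n) (perms n)
perms-length zero    = refl ∷ []
perms-length (suc n) = subst (All (λ v → length v ≡ suc n)) (sym (perms-suc n))
  (All-concatMap-upTo (λ a → map (prepend a) (perms n)) (suc n) λ a _ →
    Allₚ.map⁺ (All.map (λ {v} len → cong suc (trans (length-map (punchIn a) v) len)) (perms-length n)))

-- Hence the first letter of `prepend a v` has n ∸ a letters above it, and summing over a amounts to
-- summing over j = 0, ..., n.
perms-atLeast : ∀ n → All (λ v → ∀ a → a ≤ n → atLeast a v ≡ n ∸ a) (perms n)
perms-atLeast zero    = (λ a _ → sym (ℕₚ.0∸n≡0 a)) ∷ []
perms-atLeast (suc n) = subst (All (λ v → ∀ a → a ≤ suc n → atLeast a v ≡ suc n ∸ a)) (sym (perms-suc n))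
  (All-concatMap-upTo (λ b → map (prepend b) (perms n)) (suc n) λ b b≤n →
    Allₚ.map⁺ (All.map (λ {v} → step b (ℕ.s≤s⁻¹ b≤n) v) (perms-atLeast n)))
  where
  step : ∀ b → b ≤ n → ∀ v → (∀ a → a ≤ n → atLeast a v ≡ n ∸ a) →
         ∀ a → a ≤ suc n → atLeast a (prepend b v) ≡ suc n ∸ a
  step b b≤n v rank a a≤ with a <ᵇ suc b in eq
  ... | true  = trans (cong suc (trans (atLeast-punchIn-≤ a≤b v) (rank a (ℕₚ.≤-trans a≤b b≤n))))
                      (sym (ℕₚ.+-∸-assoc 1 (ℕₚ.≤-trans a≤b b≤n)))
    where
    a≤b : a ≤ b
    a≤b = ℕ.s≤s⁻¹ (ℕₚ.<ᵇ⇒< a (suc b) (subst T (sym eq) tt))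
  step b b≤n v rank zero    a≤       | false with () ← eq
  step b b≤n v rank (suc a) (s≤s a≤) | false = trans (atLeast-punchIn-> b≤a v) (rank a a≤)
    where
    b≤a : b ≤ a
    b≤a = ℕₚ.≮⇒≥ (λ a<b → subst T eq (ℕₚ.<⇒<ᵇ (s≤s a<b)))

sumTo : (ℕ → ℕ) → ℕ → ℕ
sumTo φ zero    = 0
sumTo φ (suc j) = φ j + sumTo φ j

sum-upTo-reverse : ∀ {g φ : ℕ → ℕ} n → (∀ a → a ≤ n → g a ≡ φ (n ∸ a)) → sum (map g (upTo (suc n))) ≡ sumTo φ (suc n)
sum-upTo-reverse zero    eq = cong (_+ 0) (eq 0 z≤n)
sum-upTo-reverse {g} (suc n) eq = cong₂ _+_ (eq 0 z≤n) (begin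
  sum (map g (applyUpTo suc (suc n)))      ≡⟨ cong (sum ∘ map g) (map-upTo suc (suc n)) ⟨
  sum (map g (map suc (upTo (suc n))))     ≡⟨ cong sum (map-∘ (upTo (suc n))) ⟨
  sum (map (g ∘ suc) (upTo (suc n)))       ≡⟨ sum-upTo-reverse n (λ a a≤n → eq (suc a) (s≤s a≤n)) ⟩
  sumTo _ (suc n)                          ∎)
  where open ≡-Reasoning

sum-map-+ : ∀ {A : Set} (f g : A → ℕ) xs → sum (map (λ x → f x + g x) xs) ≡ sum (map f xs) + sum (map g xs)
sum-map-+ f g []       = refl
sum-map-+ f g (x ∷ xs) rewrite sum-map-+ f g xs = interchange (f x) (g x) (sum (map f xs)) (sum (map g xs))

sum-map-0 : ∀ {A : Set} (xs : List A) → sum (map (λ _ → 0) xs) ≡ 0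
sum-map-0 []       = refl
sum-map-0 (x ∷ xs) = sum-map-0 xs

sum-prepend : ∀ (F : List ℕ → ℕ) as vs →
  sum (map F (concatMap (λ a → map (prepend a) vs) as)) ≡ sum (map (λ v → sum (map (λ a → F (prepend a v)) as)) vs)
sum-prepend F []       vs = sym (sum-map-0 vs)
sum-prepend F (a ∷ as) vs = begin
  sum (map F (map (prepend a) vs ++ rest))
    ≡⟨ cong sum (map-++ F (map (prepend a) vs) rest) ⟩
  sum (map F (map (prepend a) vs) ++ map F rest)
    ≡⟨ sum-++ (map F (map (prepend a) vs)) (map F rest) ⟩
  sum (map F (map (prepend a) vs)) + sum (map F rest)
    ≡⟨ cong₂ _+_ (cong sum (sym (map-∘ vs))) (sum-prepend F as vs) ⟩
  sum (map (F ∘ prepend a) vs) + sum (map (λ v → sum (map (λ a → F (prepend a v)) as)) vs)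
    ≡⟨ sum-map-+ (F ∘ prepend a) (λ v → sum (map (λ a → F (prepend a v)) as)) vs ⟨
  sum (map (λ v → sum (map (λ a → F (prepend a v)) (a ∷ as))) vs) ∎
  where
  open ≡-Reasoning
  rest = concatMap (λ a → map (prepend a) vs) as

-- The generating tree and its totals

module Codes (S L : ℕ) where
  open Weights S L

  -- The last j entries belong to the letters above the new one, rightmost first. Past the first S
  -- of these stand the letters with at least S further ones behind them; L low letters in front of
  -- such a letter would complete the second pattern.
  admissible : List ℕ → ℕ → Bool
  admissible s j = (j ≤ᵇ length s) ∧ all (_<ᵇ L) (drop S (lastN j s))

  good : List ℕ → Bool
  good []      = true
  good (a ∷ v) = good v ∧ admissible (state v) (above a v)

  good-punchIn : ∀ a v → good (map (punchIn a) v) ≡ good v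
  good-punchIn a []      = refl
  good-punchIn a (x ∷ v) =
    cong₂ _∧_ (good-punchIn a v) (cong₂ admissible (state-punchIn a v) (above-punchIn a x v))

  -- A push adds only a 0, and a truncation increments entries just checked to be below L.
  state-bounded : ∀ v → T (good v) → All (_≤ L) (drop S (state v))
  state-bounded []      _  = subst (All (_≤ L)) (sym (drop-[] S)) []
  state-bounded (a ∷ v) ok with Equivalence.to (𝔹ₚ.T-∧ {good v} {admissible (state v) (above a v)}) ok
  ... | ok-v , adm with above a v
  ... | zero  = snoc S (state v) (state-bounded v ok-v)
    where
    snoc : ∀ n s → All (_≤ L) (drop n s) → All (_≤ L) (drop n (s ++ [ 0 ]))
    snoc zero    s       s≤L = Allₚ.++⁺ s≤L (z≤n ∷ [])
    snoc (suc n) []      s≤L = subst (All (_≤ L)) (sym (drop-[] n)) []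
    snoc (suc n) (x ∷ s) s≤L = snoc n s s≤L
  ... | suc j = subst (All (_≤ L)) (sym (drop-map S (lastN (suc j) (state v))))
    (Allₚ.map⁺ (All.map (λ {x} → ℕₚ.<ᵇ⇒< x L)
      (Allₚ.all⁺ (_<ᵇ L) (drop S (lastN (suc j) (state v))) (proj₂ (Equivalence.to (𝔹ₚ.T-∧ {suc j ≤ᵇ length (state v)}) adm)))))

  goodWeight : ℕ → List ℕ → ℕ
  goodWeight m v = if good v then weight m (state v) else 0

  move : ℕ → List ℕ → ℕ → ℕ
  move m s j = if admissible s j then weight m (advance j s) else 0

  goodWeight-prepend : ∀ m a v → goodWeight m (prepend a v) ≡ (if good v then move m (state v) (atLeast a v) else 0)
  goodWeight-prepend m a v
    rewrite good-punchIn a v | state-punchIn a v | above-prepend a v with good v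
  ... | true  = refl
  ... | false = refl

  move-beyond : ∀ m s j → length s < j → move m s j ≡ 0
  move-beyond m s j len<j with j ≤ᵇ length s in eq
  ... | false = refl
  ... | true  = contradiction (ℕₚ.≤ᵇ⇒≤ j (length s) (subst T (sym eq) tt)) (ℕₚ.<⇒≱ len<j)

  move-push : ∀ m s → move m s 0 ≡ weight m (s ++ [ 0 ])
  move-push m s rewrite lastN-0 s | drop-[] {A = ℕ} S = refl

  -- If the check fails, an entry exceeds L after the increment and the right side vanishes too; the
  -- sum over suffixes therefore needs no test.
  move-truncate : ∀ m u x t → move m (u ++ x ∷ t) (length (x ∷ t)) ≡ weight m (map suc (x ∷ t))
  move-truncate m u x t
    rewrite lastN-++ u (x ∷ t)
          | Equivalence.to 𝔹ₚ.T-≡ (ℕₚ.≤⇒≤ᵇ (subst (suc (length t) ≤_) (sym (length-++ u {x ∷ t})) (ℕₚ.m≤n+m (suc (length t)) (length u))))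
    with all (_<ᵇ L) (drop S (x ∷ t)) in eq
  ... | true  = refl
  ... | false = sym (weight-exceeds m (map suc (x ∷ t)) exceeds)
    where
    too-large : ∀ d → all (_<ᵇ L) d ≡ false → Any (L <_) (map suc d)
    too-large (y ∷ d) eq with y <ᵇ L in lt
    ... | true  = there (too-large d eq)
    ... | false = here (s≤s (ℕₚ.≮⇒≥ λ y<L → subst T lt (ℕₚ.<⇒<ᵇ y<L)))
    exceeds : Any (L <_) (drop S (map suc (x ∷ t)))
    exceeds = subst (Any (L <_)) (sym (drop-map S (x ∷ t))) (too-large (drop S (x ∷ t)) eq)

  -- The state u ++ t stays fixed while the induction runs over its suffix t; u collects what has
  -- been passed.
  sum-moves-suffix : ∀ m u t → sumTo (move m (u ++ t)) (suc (length t)) ≡ weight m ((u ++ t) ++ [ 0 ]) + successors m t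
  sum-moves-suffix m u []      = cong (_+ 0) (move-push m (u ++ []))
  sum-moves-suffix m u (x ∷ t) = begin
    move m (u ++ x ∷ t) (suc (length t)) + sumTo (move m (u ++ x ∷ t)) (suc (length t))
      ≡⟨ cong₂ _+_ (move-truncate m u x t) shifted ⟩
    weight m (map suc (x ∷ t)) + (weight m ((u ++ x ∷ t) ++ [ 0 ]) + successors m t)
      ≡⟨ x∙yz≈y∙xz (weight m (map suc (x ∷ t))) (weight m ((u ++ x ∷ t) ++ [ 0 ])) (successors m t) ⟩
    weight m ((u ++ x ∷ t) ++ [ 0 ]) + (weight m (map suc (x ∷ t)) + successors m t) ∎
    where
    open ≡-Reasoning
    shifted : sumTo (move m (u ++ x ∷ t)) (suc (length t)) ≡ weight m ((u ++ x ∷ t) ++ [ 0 ]) + successors m t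
    shifted = subst (λ s → sumTo (move m s) (suc (length t)) ≡ weight m (s ++ [ 0 ]) + successors m t)
      (++-assoc u [ x ] t) (sum-moves-suffix m (u ++ [ x ]) t)

  sum-moves : ∀ m s n → All (_≤ L) (drop S s) → length s ≤ n → sumTo (move m s) (suc n) ≡ weight (suc m) s
  sum-moves m s n s≤L len≤n with ℕₚ.m≤n⇒m<n∨m≡n len≤n
  sum-moves m s (suc n) s≤L _ | inj₁ (s≤s len≤n)
    rewrite move-beyond m s (suc n) (s≤s len≤n) = sum-moves m s n s≤L len≤n
  ... | inj₂ len≡n = subst (λ l → sumTo (move m s) (suc l) ≡ weight (suc m) s) len≡n
    (trans (sum-moves-suffix m [] s) (sym (weight-suc m s s≤L)))

  goodTotal : ℕ → ℕ → ℕ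
  goodTotal n m = sum (map (goodWeight m) (perms n))

  -- A permutation of length n + 1 is one step after its standardised tail, so the total depends on
  -- n + m only and can be computed at the empty permutation.
  goodTotal-suc : ∀ n m → goodTotal (suc n) m ≡ goodTotal n (suc m)
  goodTotal-suc n m = begin
    sum (map (goodWeight m) (perms (suc n)))
      ≡⟨ cong (sum ∘ map (goodWeight m)) (perms-suc n) ⟩
    sum (map (goodWeight m) (concatMap (λ a → map (prepend a) (perms n)) (upTo (suc n))))
      ≡⟨ sum-prepend (goodWeight m) (upTo (suc n)) (perms n) ⟩
    sum (map (λ v → sum (map (λ a → goodWeight m (prepend a v)) (upTo (suc n)))) (perms n))
      ≡⟨ cong sum (map-cong-local (All.zipWith (λ {v} → extensions v) (perms-length n , perms-atLeast n))) ⟩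
    sum (map (goodWeight (suc m)) (perms n)) ∎
    where
    open ≡-Reasoning
    sumTo-0 : ∀ j → sumTo (λ _ → 0) j ≡ 0
    sumTo-0 zero    = refl
    sumTo-0 (suc j) = sumTo-0 j
    collapse : ∀ v → length v ≡ n →
      sumTo (λ j → if good v then move m (state v) j else 0) (suc n) ≡ goodWeight (suc m) v
    collapse v len with good v in eq
    ... | true  = sum-moves m (state v) n (state-bounded v (subst T (sym eq) tt)) (subst (length (state v) ≤_) len (length-state v))
    ... | false = sumTo-0 n
    extensions : ∀ v → length v ≡ n × (∀ a → a ≤ n → atLeast a v ≡ n ∸ a) →
      sum (map (λ a → goodWeight m (prepend a v)) (upTo (suc n))) ≡ goodWeight (suc m) v
    extensions v (len , rank) = trans
      (sum-upTo-reverse {φ = λ j → if good v then move m (state v) j else 0} n λ a a≤n →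
        trans (goodWeight-prepend m a v) (cong (λ j → if good v then move m (state v) j else 0) (rank a a≤n)))
      (collapse v len)

  goodTotal-0 : ∀ n m → goodTotal n m ≡ ballot ceiling 0 (n + m)
  goodTotal-0 zero    m = trans (ℕₚ.+-identityʳ _) (weight-short m [] z≤n)
  goodTotal-0 (suc n) m = trans (goodTotal-suc n m) (trans (goodTotal-0 n (suc m)) (cong (ballot ceiling 0) (ℕₚ.+-suc n m)))

  count-good : ∀ n → length (filterᵇ good (perms n)) ≡ ballot ceiling 0 n
  count-good n = trans (as-sum (perms n)) (trans (goodTotal-0 n 0) (cong (ballot ceiling 0) (ℕₚ.+-identityʳ n)))
    where
    as-sum : ∀ vs → length (filterᵇ good vs) ≡ sum (map (goodWeight 0) vs)
    as-sum []       = refl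
    as-sum (v ∷ vs) with good v in eq
    ... | true  = cong₂ _+_ (sym (weight-0 (state v) (state-bounded v (subst T (sym eq) tt)))) (as-sum vs)
    ... | false = as-sum vs

-- Occurrences of patterns

Decreasing : List ℕ → Set
Decreasing = AllPairs _>_

<⇒<ᵇ≡true : ∀ {m n} → m < n → (m <ᵇ n) ≡ true
<⇒<ᵇ≡true m<n = Equivalence.to 𝔹ₚ.T-≡ (ℕₚ.<⇒<ᵇ m<n)

≤⇒<ᵇ≡false : ∀ {m n} → n ≤ m → (m <ᵇ n) ≡ false
≤⇒<ᵇ≡false {m} {n} n≤m with m <ᵇ n in eq
... | false = refl
... | true  = contradiction (ℕₚ.<ᵇ⇒< m n (subst T (sym eq) tt)) (ℕₚ.≤⇒≯ n≤m)

Contains : List ℕ → List ℕ → Set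
Contains τ v = ∃ λ σ → σ ⊆ v × T (orderIsoᵇ σ τ)

subseqs⁻ : ∀ {P : List ℕ → Set} v → Any P (subseqs v) → ∃ λ σ → σ ⊆ v × P σ
subseqs⁻ []      (here p) = [] , [] , p
subseqs⁻ {P} (x ∷ v) any with Anyₚ.++⁻ (map (x ∷_) (subseqs v)) any
... | inj₁ taken   = let σ , σ⊆v , p = subseqs⁻ {P ∘ (x ∷_)} v (Anyₚ.map⁻ taken) in x ∷ σ , refl ∷ σ⊆v , p
... | inj₂ skipped = let σ , σ⊆v , p = subseqs⁻ v skipped in σ , x ∷ʳ σ⊆v , p

subseqs⁺ : ∀ {P : List ℕ → Set} {σ v} → σ ⊆ v → P σ → Any P (subseqs v)
subseqs⁺ []            p = here p
subseqs⁺ {v = x ∷ v} (x ∷ʳ σ⊆v) p = Anyₚ.++⁺ʳ (map (x ∷_) (subseqs v)) (subseqs⁺ σ⊆v p)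
subseqs⁺ {P} (refl ∷ σ⊆v) p = Anyₚ.++⁺ˡ (Anyₚ.map⁺ (subseqs⁺ {P ∘ (_ ∷_)} σ⊆v p))

containsᵇ⇒Contains : ∀ τ v → T (containsᵇ τ v) → Contains τ v
containsᵇ⇒Contains τ v c = subseqs⁻ v (Anyₚ.any⁻ (λ σ → orderIsoᵇ σ τ) (subseqs v) c)

Contains⇒containsᵇ : ∀ {τ v} → Contains τ v → T (containsᵇ τ v)
Contains⇒containsᵇ {τ} (σ , σ⊆v , iso) = Anyₚ.any⁺ (λ σ → orderIsoᵇ σ τ) (subseqs⁺ σ⊆v iso)

boolEq⇒≡ : ∀ b c → T (boolEq b c) → b ≡ c
boolEq⇒≡ true  true  _ = refl
boolEq⇒≡ false false _ = refl

≡⇒boolEq : ∀ {b c} → b ≡ c → T (boolEq b c)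
≡⇒boolEq {true}  refl = tt
≡⇒boolEq {false} refl = tt

SameOrder : ℕ × ℕ → ℕ × ℕ → Set
SameOrder (s , t) (s′ , t′) = (s <ᵇ s′) ≡ (t <ᵇ t′)

-- `orderIsoᵇ` compares all ordered pairs of positions; with both directions recorded, `AllPairs`
-- suffices and follows the concatenation of layers.
Concordant : ℕ × ℕ → ℕ × ℕ → Set
Concordant p q = SameOrder p q × SameOrder q p

concordant-< : ∀ {s t s′ t′} → s < s′ → t < t′ → Concordant (s , t) (s′ , t′)
concordant-< s<s′ t<t′ =
  trans (<⇒<ᵇ≡true s<s′) (sym (<⇒<ᵇ≡true t<t′)) ,
  trans (≤⇒<ᵇ≡false (ℕₚ.<⇒≤ s<s′)) (sym (≤⇒<ᵇ≡false (ℕₚ.<⇒≤ t<t′)))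

concordant-> : ∀ {s t s′ t′} → s > s′ → t > t′ → Concordant (s , t) (s′ , t′)
concordant-> s>s′ t>t′ = let a , b = concordant-< s>s′ t>t′ in b , a

orderIsoᵇ⇒ : ∀ σ τ → T (orderIsoᵇ σ τ) →
  length σ ≡ length τ × All (λ p → All (SameOrder p) (zip σ τ)) (zip σ τ)
orderIsoᵇ⇒ σ τ iso =
  let len , alls = Equivalence.to (𝔹ₚ.T-∧ {length σ ≡ᵇ length τ}) iso in
  ℕₚ.≡ᵇ⇒≡ (length σ) (length τ) len ,
  All.map (λ row → All.map (boolEq⇒≡ _ _) (Allₚ.all⁺ _ _ row)) (Allₚ.all⁺ _ (zip σ τ) alls)

orderIsoᵇ⇐ : ∀ σ τ → length σ ≡ length τ → AllPairs Concordant (zip σ τ) → T (orderIsoᵇ σ τ)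
orderIsoᵇ⇐ σ τ len pairs = Equivalence.from (𝔹ₚ.T-∧ {length σ ≡ᵇ length τ})
  (ℕₚ.≡⇒≡ᵇ (length σ) (length τ) len , Allₚ.all⁻ _ (All.map (λ row → Allₚ.all⁻ _ (All.map ≡⇒boolEq row)) (everywhere pairs)))
  where
  sameOrder-refl : ∀ p → SameOrder p p
  sameOrder-refl (s , t) = trans (≤⇒<ᵇ≡false {s} ℕₚ.≤-refl) (sym (≤⇒<ᵇ≡false {t} ℕₚ.≤-refl))
  everywhere : ∀ {zs} → AllPairs Concordant zs → All (λ p → All (SameOrder p) zs) zs
  everywhere []                   = []
  everywhere {p ∷ zs} (row ∷ pairs) =
    (sameOrder-refl p ∷ All.map proj₁ row) ∷ All.zipWith (λ (c , rest) → proj₂ c ∷ rest) (row , everywhere pairs)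

Ascents₃ : List ℕ → Set
Ascents₃ v = ∃₂ λ x y → ∃ λ z → (x ∷ y ∷ z ∷ [] ⊆ v) × x < y × y < z

sameOrder⇒< : ∀ {s t s′ t′} → SameOrder (s , t) (s′ , t′) → t < t′ → s < s′
sameOrder⇒< {s} {s′ = s′} same t<t′ = ℕₚ.<ᵇ⇒< s s′ (subst T (sym same) (ℕₚ.<⇒<ᵇ t<t′))

ascending-iso : ∀ σ {x y z} → x < y → y < z → T (orderIsoᵇ σ (x ∷ y ∷ z ∷ [])) →
  ∃₂ λ a b → ∃ λ c → σ ≡ a ∷ b ∷ c ∷ [] × a < b × b < c
ascending-iso σ {x} {y} {z} x<y y<z iso with orderIsoᵇ⇒ σ (x ∷ y ∷ z ∷ []) iso
ascending-iso (a ∷ b ∷ c ∷ []) x<y y<z iso | len , ((_ ∷ ab ∷ _) ∷ (_ ∷ _ ∷ bc ∷ []) ∷ _) =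
  a , b , c , refl , sameOrder⇒< ab x<y , sameOrder⇒< bc y<z

Contains-123⇒ : ∀ {v} → Contains p123 v → Ascents₃ v
Contains-123⇒ (σ , σ⊆v , iso) with ascending-iso σ {0} {1} {2} (s≤s z≤n) (s≤s (s≤s z≤n)) iso
... | a , b , c , refl , a<b , b<c = a , b , c , σ⊆v , a<b , b<c

Contains-123⇐ : ∀ {v} → Ascents₃ v → Contains p123 v
Contains-123⇐ (a , b , c , abc⊆v , a<b , b<c) = a ∷ b ∷ c ∷ [] , abc⊆v ,
  orderIsoᵇ⇐ (a ∷ b ∷ c ∷ []) p123 refl
    ((concordant-< {t = 0} {t′ = 1} a<b (s≤s z≤n) ∷ concordant-< {t = 0} {t′ = 2} (ℕₚ.<-trans a<b b<c) (s≤s z≤n) ∷ []) ∷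
     (concordant-< {t = 1} {t′ = 2} b<c (s≤s (s≤s z≤n)) ∷ []) ∷ [] ∷ [])

layer-decreasing : ∀ b m → Decreasing (map (λ x → b + x) (downFrom m))
layer-decreasing b m = subst Decreasing (sym (map-downFrom (λ x → b + x) m))
  (AllPairsₚ.applyDownFrom⁺₁ (λ x → b + x) m λ j<i _ → ℕₚ.+-monoʳ-< b j<i)

length-layer : ∀ b m → length (map (λ x → b + x) (downFrom m)) ≡ m
length-layer b m = trans (length-map (λ x → b + x) (downFrom m)) (length-downFrom m)

layer-bounds : ∀ b m → All (λ x → b ≤ x × x < b + m) (map (λ x → b + x) (downFrom m))
layer-bounds b m = subst (All _) (sym (map-downFrom (λ x → b + x) m))
  (Allₚ.applyDownFrom⁺₁ (λ x → b + x) m λ {i} i<m → ℕₚ.m≤m+n b i , ℕₚ.+-monoʳ-< b i<m)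

zip-concordant : ∀ {σ τ} → Decreasing σ → Decreasing τ → AllPairs Concordant (zip σ τ)
zip-concordant []          _           = []
zip-concordant (_ ∷ _)     []          = []
zip-concordant (s> ∷ σ↓) (t> ∷ τ↓) = zip-row s> t> ∷ zip-concordant σ↓ τ↓
  where
  zip-row : ∀ {s t σ τ} → All (s >_) σ → All (t >_) τ → All (Concordant (s , t)) (zip σ τ)
  zip-row []        _         = []
  zip-row (_ ∷ _)   []        = []
  zip-row (p ∷ ps) (q ∷ qs) = concordant-> p q ∷ zip-row ps qs

zip-All : ∀ {P Q : ℕ → Set} {σ τ} → All P σ → All Q τ → All (λ (s , t) → P s × Q t) (zip σ τ)
zip-All []       _        = []
zip-All (_ ∷ _)  []       = []
zip-All (p ∷ ps) (q ∷ qs) = (p , q) ∷ zip-All ps qs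

zip-++ : ∀ σ₁ {σ₂} τ₁ {τ₂ : List ℕ} → length σ₁ ≡ length τ₁ → zip {A = ℕ} (σ₁ ++ σ₂) (τ₁ ++ τ₂) ≡ zip σ₁ τ₁ ++ zip σ₂ τ₂
zip-++ []       []       _   = refl
zip-++ (s ∷ σ₁) (t ∷ τ₁) len = cong ((s , t) ∷_) (zip-++ σ₁ τ₁ (ℕₚ.suc-injective len))

unzip-decreasing : ∀ σ τ → length σ ≡ length τ → All (λ p → All (SameOrder p) (zip σ τ)) (zip σ τ) →
  Decreasing τ → Decreasing σ
unzip-decreasing []      []      _   _          []        = []
unzip-decreasing (s ∷ σ) (t ∷ τ) len (_ ∷ rows) (t> ∷ τ↓) =
  column σ τ (ℕₚ.suc-injective len) t> (All.map All.head rows) ∷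
  unzip-decreasing σ τ (ℕₚ.suc-injective len) (All.map All.tail rows) τ↓
  where
  column : ∀ {s t} σ τ → length σ ≡ length τ → All (t >_) τ → All (λ p → SameOrder p (s , t)) (zip σ τ) → All (s >_) σ
  column []      []      _   []         []             = []
  column (s ∷ σ) (t ∷ τ) len (t> ∷ τ>) (same ∷ sames) =
    sameOrder⇒< same t> ∷ column σ τ (ℕₚ.suc-injective len) τ> sames

Contains-1-layer⇒ : ∀ {k v} → Contains (w (k ∷ [])) v → ∃ λ σ → σ ⊆ v × Decreasing σ × length σ ≡ k
Contains-1-layer⇒ {k} (σ , σ⊆v , iso) rewrite ++-identityʳ (map (0 +_) (downFrom k)) =
  let len , same = orderIsoᵇ⇒ σ (map (0 +_) (downFrom k)) iso in
  σ , σ⊆v , unzip-decreasing σ _ len same (layer-decreasing 0 k) , trans len (length-layer 0 k)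

Contains-1-layer⇐ : ∀ {k v} → (∃ λ σ → σ ⊆ v × Decreasing σ × length σ ≡ k) → Contains (w (k ∷ [])) v
Contains-1-layer⇐ {k} (σ , σ⊆v , σ↓ , len) rewrite ++-identityʳ (map (0 +_) (downFrom k)) =
  σ , σ⊆v , orderIsoᵇ⇐ σ _ (trans len (sym (length-layer 0 k))) (zip-concordant σ↓ (layer-decreasing 0 k))

-- The first letter of an occurrence of w(r+1,s) is the pivot that separates the remaining letters.
LowHigh : ℕ → ℕ → ℕ → List ℕ → Set
LowHigh r s a v = ∃₂ λ σ₁ σ₂ → (σ₁ ++ σ₂ ⊆ v) × length σ₁ ≡ r × length σ₂ ≡ s × All (_< a) σ₁ × All (a <_) σ₂

-- Only comparisons with the pivot are kept; the decrease inside the two groups is recovered from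
-- the absence of 123 in `pivotedLowHigh-Contains`.
PivotedLowHigh : ℕ → ℕ → List ℕ → Set
PivotedLowHigh r s v = ∃ λ a → ∃₂ λ σ₁ σ₂ →
  (a ∷ σ₁ ++ σ₂ ⊆ v) × length σ₁ ≡ r × length σ₂ ≡ s × All (_< a) σ₁ × All (a <_) σ₂

Contains-2-layers⇒ : ∀ {r s v} → Contains (w (suc r ∷ s ∷ [])) v → PivotedLowHigh r s v
Contains-2-layers⇒ {r} {s} (σ , σ⊆v , iso) rewrite ++-identityʳ (map (λ x → suc r + x) (downFrom s)) =
  split σ σ⊆v (orderIsoᵇ⇒ σ _ iso)
  where
  low  = map (0 +_) (downFrom r)
  high = map (λ x → suc r + x) (downFrom s)
  separate : ∀ {a} σ τ₁ {τ₂} → length σ ≡ length (τ₁ ++ τ₂) →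
    All (λ p → SameOrder (a , r) p × SameOrder p (a , r)) (zip σ (τ₁ ++ τ₂)) → All (_< r) τ₁ → All (r <_) τ₂ →
    ∃₂ λ σ₁ σ₂ → σ ≡ σ₁ ++ σ₂ × length σ₁ ≡ length τ₁ × length σ₂ ≡ length τ₂ × All (_< a) σ₁ × All (a <_) σ₂
  separate []      []       {[]}     len _          _          _          = [] , [] , refl , refl , refl , [] , []
  separate (s ∷ σ) []       {t ∷ τ₂} len (c ∷ cs)   []         (t> ∷ τ₂>) with separate σ [] (ℕₚ.suc-injective len) cs [] τ₂>
  ... | [] , σ₂ , refl , _ , len₂ , _ , σ₂> = [] , s ∷ σ₂ , refl , refl , cong suc len₂ , [] , sameOrder⇒< (proj₁ c) t> ∷ σ₂>
  separate (s ∷ σ) (t ∷ τ₁)          len (c ∷ cs)   (t< ∷ τ₁<) τ₂>        with separate σ τ₁ (ℕₚ.suc-injective len) cs τ₁< τ₂>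
  ... | σ₁ , σ₂ , refl , len₁ , len₂ , σ₁< , σ₂> =
    s ∷ σ₁ , σ₂ , refl , cong suc len₁ , len₂ , sameOrder⇒< (proj₂ c) t< ∷ σ₁< , σ₂>
  split : ∀ {v} σ → σ ⊆ v →
    length σ ≡ length (r ∷ low ++ high) × All (λ p → All (SameOrder p) (zip σ (r ∷ low ++ high))) (zip σ (r ∷ low ++ high)) →
    PivotedLowHigh r s v
  split (a ∷ σ) σ⊆v (len , (_ ∷ row) ∷ rows)
    with separate σ low (ℕₚ.suc-injective len) (All.zipWith (λ x → x) (row , All.map All.head rows))
           (All.map proj₂ (layer-bounds 0 r)) (All.map proj₁ (layer-bounds (suc r) s))
  ... | σ₁ , σ₂ , refl , len₁ , len₂ , σ₁< , σ₂> =
    a , σ₁ , σ₂ , σ⊆v , trans len₁ (length-layer 0 r) , trans len₂ (length-layer (suc r) s) , σ₁< , σ₂>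

Contains-2-layers⇐ : ∀ {r s v} → (∃ λ a → ∃₂ λ σ₁ σ₂ → (a ∷ σ₁ ++ σ₂ ⊆ v) × length σ₁ ≡ r × length σ₂ ≡ s ×
  All (_< a) σ₁ × All (a <_) σ₂ × Decreasing σ₁ × Decreasing σ₂) → Contains (w (suc r ∷ s ∷ [])) v
Contains-2-layers⇐ {r} {s} (a , σ₁ , σ₂ , σ⊆v , len₁ , len₂ , σ₁< , σ₂> , σ₁↓ , σ₂↓)
  rewrite ++-identityʳ (map (λ x → suc r + x) (downFrom s)) =
  a ∷ σ₁ ++ σ₂ , σ⊆v , orderIsoᵇ⇐ (a ∷ σ₁ ++ σ₂) (low ++ high) len concordant
  where
  low  = map (0 +_) (downFrom (suc r))
  high = map (λ x → suc r + x) (downFrom s)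
  len-low : length (a ∷ σ₁) ≡ length low
  len-low = trans (cong suc len₁) (sym (length-layer 0 (suc r)))
  len : length (a ∷ σ₁ ++ σ₂) ≡ length (low ++ high)
  len = trans (length-++ (a ∷ σ₁)) (trans (cong₂ _+_ len-low (trans len₂ (sym (length-layer (suc r) s)))) (sym (length-++ low)))
  -- Low and high letters are compared through the pivots, a in the word and r in the pattern, each
  -- the largest of its first layer.
  cross : All (λ p → All (Concordant p) (zip σ₂ high)) (zip (a ∷ σ₁) low)
  cross = All.map
    (λ (s≤a , t≤r) → All.map (λ (a<s′ , r<t′) → concordant-< (ℕₚ.≤-<-trans s≤a a<s′) (ℕₚ.≤-<-trans t≤r r<t′))
      (zip-All σ₂> (All.map proj₁ (layer-bounds (suc r) s))))
    (zip-All {P = _≤ a} {Q = _≤ r} (ℕₚ.≤-refl ∷ All.map ℕₚ.<⇒≤ σ₁<) (All.map (ℕ.s≤s⁻¹ ∘ proj₂) (layer-bounds 0 (suc r))))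
  concordant : AllPairs Concordant (zip (a ∷ σ₁ ++ σ₂) (low ++ high))
  concordant = subst (AllPairs Concordant) (sym (zip-++ (a ∷ σ₁) low len-low))
    (AllPairsₚ.++⁺ (zip-concordant (σ₁< ∷ σ₁↓) (layer-decreasing 0 (suc r)))
                   (zip-concordant σ₂↓ (layer-decreasing (suc r) s)) cross)

zip-⊆ : ∀ {σ τ τ′ : List ℕ} → length σ ≡ length τ → τ′ ⊆ τ →
  ∃ λ σ′ → σ′ ⊆ σ × length σ′ ≡ length τ′ × zip σ′ τ′ ⊆ zip σ τ
zip-⊆ {[]}    _   []          = [] , [] , refl , []
zip-⊆ {s ∷ σ} len (t ∷ʳ τ′⊆τ) =
  let σ′ , σ′⊆σ , len′ , zip′ = zip-⊆ {σ} (ℕₚ.suc-injective len) τ′⊆τ in σ′ , s ∷ʳ σ′⊆σ , len′ , (s , t) ∷ʳ zip′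
zip-⊆ {s ∷ σ} len (refl ∷ τ′⊆τ) =
  let σ′ , σ′⊆σ , len′ , zip′ = zip-⊆ {σ} (ℕₚ.suc-injective len) τ′⊆τ in s ∷ σ′ , refl ∷ σ′⊆σ , cong suc len′ , refl ∷ zip′

Contains-ascents⇒ : ∀ {τ v} → Ascents₃ τ → Contains τ v → Ascents₃ v
Contains-ascents⇒ {τ} (x , y , z , xyz⊆τ , x<y , y<z) (σ , σ⊆v , iso) with orderIsoᵇ⇒ σ τ iso
... | len , same with zip-⊆ {σ} len xyz⊆τ
... | a ∷ b ∷ c ∷ [] , abc⊆σ , _ , zip′
    with Sublistₚ.All-resp-⊆ zip′ (All.map (Sublistₚ.All-resp-⊆ zip′) same)
... | (_ ∷ ab ∷ _) ∷ (_ ∷ _ ∷ bc ∷ []) ∷ _ =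
  a , b , c , ⊆-trans abc⊆σ σ⊆v , sameOrder⇒< ab x<y , sameOrder⇒< bc y<z

-- The witnesses are the first letters of the first three layers.
3-layers-ascents : ∀ b m₁ m₂ m₃ ks → Ascents₃ (layeredFrom b (suc m₁ ∷ suc m₂ ∷ suc m₃ ∷ ks))
3-layers-ascents b m₁ m₂ m₃ ks =
  b + m₁ , b + suc m₁ + m₂ , b + suc m₁ + suc m₂ + m₃ ,
  refl ∷ Sublistₚ.++⁺ˡ (map (λ x → b + x) (downFrom m₁))
    (refl ∷ Sublistₚ.++⁺ˡ (map (λ x → b + suc m₁ + x) (downFrom m₂)) (refl ∷ Sublistₚ.[]⊆-universal _)) ,
  ℕₚ.≤-trans (ℕₚ.+-monoʳ-< b (ℕₚ.n<1+n m₁)) (ℕₚ.m≤m+n (b + suc m₁) m₂) ,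
  ℕₚ.≤-trans (ℕₚ.+-monoʳ-< (b + suc m₁) (ℕₚ.n<1+n m₂)) (ℕₚ.m≤m+n (b + suc m₁ + suc m₂) m₃)

-- Reading avoidance off the states

above-∷-< : ∀ {a b} v → a < b → above a (b ∷ v) ≡ suc (above a v)
above-∷-< v a<b rewrite <⇒<ᵇ≡true a<b = refl

above-∷-≥ : ∀ {a b} v → b ≤ a → above a (b ∷ v) ≡ above a v
above-∷-≥ v b≤a rewrite ≤⇒<ᵇ≡false b≤a = refl

above-antitone : ∀ {a b} → a ≤ b → ∀ v → above b v ≤ above a v
above-antitone a≤b []      = z≤n
above-antitone {a} {b} a≤b (x ∷ v) with ℕₚ.<-≤-connex b x
... | inj₁ b<x rewrite above-∷-< v b<x | above-∷-< v (ℕₚ.≤-<-trans a≤b b<x) = s≤s (above-antitone a≤b v)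
... | inj₂ x≤b rewrite above-∷-≥ v x≤b with ℕₚ.<-≤-connex a x
... | inj₁ a<x rewrite above-∷-< v a<x = ℕₚ.m≤n⇒m≤1+n (above-antitone a≤b v)
... | inj₂ x≤a rewrite above-∷-≥ v x≤a = above-antitone a≤b v

above-⊆ : ∀ {a} v {σ} → σ ⊆ v → All (a <_) σ → length σ ≤ above a v
above-⊆ []      []           []          = z≤n
above-⊆ {a} (x ∷ v) (x ∷ʳ σ⊆v) σ>          with ℕₚ.<-≤-connex a x
... | inj₁ a<x rewrite above-∷-< v a<x = ℕₚ.m≤n⇒m≤1+n (above-⊆ v σ⊆v σ>)
... | inj₂ x≤a rewrite above-∷-≥ v x≤a = above-⊆ v σ⊆v σ>
above-⊆ (x ∷ v) (refl ∷ σ⊆v) (a<x ∷ σ>) rewrite above-∷-< v a<x = s≤s (above-⊆ v σ⊆v σ>)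

above-witness : ∀ {a} v k → k ≤ above a v → ∃ λ σ → σ ⊆ v × length σ ≡ k × All (a <_) σ
above-witness v       zero    _  = [] , Sublistₚ.[]⊆-universal v , refl , []
above-witness {a} (x ∷ v) (suc k) k< with ℕₚ.<-≤-connex a x
... | inj₁ a<x with above-witness v k (ℕ.s≤s⁻¹ (subst (suc k ≤_) (above-∷-< v a<x) k<))
... | σ , σ⊆v , len , σ> = x ∷ σ , refl ∷ σ⊆v , cong suc len , a<x ∷ σ>
above-witness {a} (x ∷ v) (suc k) k< | inj₂ x≤a with above-witness v (suc k) (subst (suc k ≤_) (above-∷-≥ v x≤a) k<)
... | σ , σ⊆v , len , σ> = σ , x ∷ʳ σ⊆v , len , σ>

-- For distinct letters: those above a decrease. It is phrased through `above` so that it follows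
-- the recursion of `state`.
NoAscentAbove : ℕ → List ℕ → Set
NoAscentAbove a []      = ⊤
NoAscentAbove a (b ∷ v) = (a < b → above b v ≡ 0) × NoAscentAbove a v

noAscentAbove⁺ : ∀ a v → (∀ {x y} → x ∷ y ∷ [] ⊆ v → a < x → ¬ x < y) → NoAscentAbove a v
noAscentAbove⁺ a []      _    = tt
noAscentAbove⁺ a (b ∷ v) none = last-above , noAscentAbove⁺ a v (λ xy⊆v → none (b ∷ʳ xy⊆v))
  where
  last-above : a < b → above b v ≡ 0
  last-above a<b with above b v in eq
  ... | zero  = refl
  ... | suc j with above-witness {b} v 1 (subst (1 ≤_) (sym eq) (s≤s z≤n))
  ... | y ∷ [] , y⊆v , _ , b<y ∷ [] = contradiction b<y (none (refl ∷ y⊆v) a<b)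

noAscentAbove⁻ : ∀ {a} v → NoAscentAbove a v → ∀ {x y} → x ∷ y ∷ [] ⊆ v → a < x → ¬ x < y
noAscentAbove⁻ (b ∷ v) (_ , none)    (b ∷ʳ xy⊆v)  a<x x<y = noAscentAbove⁻ v none xy⊆v a<x x<y
noAscentAbove⁻ (b ∷ v) (last , none) (refl ∷ y⊆v) a<x x<y =
  contradiction (subst (1 ≤_) (last a<x) (above-⊆ v y⊆v (x<y ∷ []))) λ ()

noAscentAbove-mono : ∀ {a b} → a ≤ b → ∀ v → NoAscentAbove a v → NoAscentAbove b v
noAscentAbove-mono a≤b []      _             = tt
noAscentAbove-mono a≤b (x ∷ v) (last , none) = (λ b<x → last (ℕₚ.≤-<-trans a≤b b<x)) , noAscentAbove-mono a≤b v none

¬Ascents₃⇒NoAscentAbove : ∀ a v → ¬ Ascents₃ (a ∷ v) → NoAscentAbove a v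
¬Ascents₃⇒NoAscentAbove a v none = noAscentAbove⁺ a v
  λ {x} {y} xy⊆v a<x x<y → none (a , x , y , refl ∷ xy⊆v , a<x , x<y)

¬Ascents₃-⊆ : ∀ {u v} → u ⊆ v → ¬ Ascents₃ v → ¬ Ascents₃ u
¬Ascents₃-⊆ u⊆v none (x , y , z , xyz⊆u , x<y , y<z) = none (x , y , z , ⊆-trans xyz⊆u u⊆v , x<y , y<z)

length-advance : ∀ j s → suc j ≤ length s → length (advance (suc j) s) ≡ suc j
length-advance j s j<len = trans (length-map suc (lastN (suc j) s))
  (trans (length-drop (length s ∸ suc j) s) (ℕₚ.m∸[m∸n]≡n j<len))

-- The state is as long as the decreasing run of top values, so the letters above a decrease exactly
-- when they all belong to that run. A front letter above a must be a new maximum and lengthens the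
-- run; one below a cuts the run down to letters that still include those above a.
noAscentAbove⇒above≤ : ∀ a v → All (a ≢_) v → Unique v → ¬ Ascents₃ v → NoAscentAbove a v → above a v ≤ length (state v)
above≤⇒noAscentAbove : ∀ a v → All (a ≢_) v → Unique v → ¬ Ascents₃ v → above a v ≤ length (state v) → NoAscentAbove a v

noAscentAbove⇒above≤ a []      _            _            _  _             = z≤n
noAscentAbove⇒above≤ a (b ∷ v) (a≢b ∷ a∉v) (b∉v ∷ v!) av (last , none) with ℕₚ.<-cmp a b
... | tri≈ _ a≡b _ = contradiction a≡b a≢b
... | tri< a<b _ _ rewrite above-∷-< v a<b | last a<b | length-snoc (state v) 0 =
  s≤s (noAscentAbove⇒above≤ a v a∉v v! (¬Ascents₃-⊆ (b ∷ʳ ⊆-refl) av) none)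
... | tri> _ _ b<a rewrite above-∷-≥ v (ℕₚ.<⇒≤ b<a) with above b v in eq
... | zero  = ℕₚ.≤-trans (above-antitone (ℕₚ.<⇒≤ b<a) v) (subst (_≤ _) (sym eq) z≤n)
... | suc j = subst (above a v ≤_)
  (trans (sym eq) (trans eq (sym (length-advance j (state v) (subst (_≤ length (state v)) eq
    (noAscentAbove⇒above≤ b v b∉v v! (¬Ascents₃-⊆ (b ∷ʳ ⊆-refl) av) (¬Ascents₃⇒NoAscentAbove b v av)))))))
  (subst (above a v ≤_) eq (above-antitone (ℕₚ.<⇒≤ b<a) v))

above≤⇒noAscentAbove a []      _            _            _  _  = tt
above≤⇒noAscentAbove a (b ∷ v) (a≢b ∷ a∉v) (b∉v ∷ v!) av ≤len with ℕₚ.<-cmp a b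
... | tri≈ _ a≡b _ = contradiction a≡b a≢b
... | tri> ¬a<b _ b<a = (λ a<b → contradiction a<b ¬a<b) ,
  noAscentAbove-mono (ℕₚ.<⇒≤ b<a) v (¬Ascents₃⇒NoAscentAbove b v av)
... | tri< a<b _ _ rewrite above-∷-< v a<b with above b v in eq
... | zero  = (λ _ → refl) , above≤⇒noAscentAbove a v a∉v v! (¬Ascents₃-⊆ (b ∷ʳ ⊆-refl) av)
  (ℕ.s≤s⁻¹ (subst (suc (above a v) ≤_) (length-snoc (state v) 0) ≤len))
-- Here b is above a without being a maximum: the run has been cut to the letters above b, too few
-- because b itself is also above a.
... | suc j = contradiction
  (ℕₚ.≤-trans ≤len (ℕₚ.≤-reflexive (length-advance j (state v) (subst (_≤ length (state v)) eq
    (noAscentAbove⇒above≤ b v b∉v v! (¬Ascents₃-⊆ (b ∷ʳ ⊆-refl) av) (¬Ascents₃⇒NoAscentAbove b v av))))))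
  (ℕₚ.<⇒≱ (s≤s (subst (_≤ above a v) eq (above-antitone (ℕₚ.<⇒≤ a<b) v))))

-- For each letter of v above a, from right to left: the number of letters below a in front of it.
lowsBefore : ℕ → List ℕ → List ℕ
lowsBefore a []      = []
lowsBefore a (b ∷ v) = if a <ᵇ b then lowsBefore a v ++ [ 0 ] else map suc (lowsBefore a v)

length-lowsBefore : ∀ a v → length (lowsBefore a v) ≡ above a v
length-lowsBefore a []      = refl
length-lowsBefore a (b ∷ v) with a <ᵇ b
... | true  = trans (length-snoc (lowsBefore a v) 0) (cong suc (length-lowsBefore a v))
... | false = trans (length-map suc (lowsBefore a v)) (length-lowsBefore a v)

lastN-snoc : ∀ j s y → lastN (suc j) (s ++ [ y ]) ≡ lastN j s ++ [ y ]
lastN-snoc j s y rewrite length-snoc s y =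
  drop-snoc s y (length s ∸ j) (ℕₚ.m∸n≤m (length s) j)

lastN-map : ∀ j (f : ℕ → ℕ) s → lastN j (map f s) ≡ map f (lastN j s)
lastN-map j f s rewrite length-map f s = drop-map (length s ∸ j) s

lastN-lastN : ∀ i j s → i ≤ j → j ≤ length s → lastN i (lastN j s) ≡ lastN i s
lastN-lastN i j s i≤j j≤len rewrite length-drop (length s ∸ j) s | ℕₚ.m∸[m∸n]≡n j≤len =
  trans (drop-drop (length s ∸ j) (j ∸ i) s) (cong (λ d → drop d s) (begin
    length s ∸ j + (j ∸ i) ≡⟨ ℕₚ.+-∸-assoc (length s ∸ j) i≤j ⟨
    length s ∸ j + j ∸ i   ≡⟨ cong (_∸ i) (ℕₚ.m∸n+n≡m j≤len) ⟩
    length s ∸ i           ∎))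
  where open ≡-Reasoning

-- The letters above a are the top values, hence the end of the state. As they decrease, a letter in
-- front of one of them is smaller than it exactly when it is below a, so the two counts agree.
lowsBefore-state : ∀ a v → All (a ≢_) v → Unique v → ¬ Ascents₃ v → NoAscentAbove a v →
  lowsBefore a v ≡ lastN (above a v) (state v)
lowsBefore-state a []      _            _            _  _             = refl
lowsBefore-state a (b ∷ v) (a≢b ∷ a∉v) (b∉v ∷ v!) av (last , none)
  with lowsBefore-state a v a∉v v! (¬Ascents₃-⊆ (b ∷ʳ ⊆-refl) av) none | ℕₚ.<-cmp a b
... | _  | tri≈ _ a≡b _ = contradiction a≡b a≢b
... | ih | tri< a<b _ _ rewrite <⇒<ᵇ≡true a<b | last a<b =
  trans (cong (_++ [ 0 ]) ih) (sym (lastN-snoc (above a v) (state v) 0))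
... | ih | tri> _ _ b<a rewrite ≤⇒<ᵇ≡false (ℕₚ.<⇒≤ b<a) with above b v in eq
... | zero  rewrite ℕₚ.n≤0⇒n≡0 (subst (above a v ≤_) eq (above-antitone (ℕₚ.<⇒≤ b<a) v)) =
  trans (cong (map suc) (trans ih (lastN-0 (state v)))) (sym (lastN-0 (state v ++ [ 0 ])))
... | suc j = begin
  map suc (lowsBefore a v)                            ≡⟨ cong (map suc) ih ⟩
  map suc (lastN (above a v) (state v))               ≡⟨ cong (map suc) (lastN-lastN (above a v) (suc j) (state v) a≤j j≤len) ⟨
  map suc (lastN (above a v) (lastN (suc j) (state v))) ≡⟨ lastN-map (above a v) suc (lastN (suc j) (state v)) ⟨
  lastN (above a v) (map suc (lastN (suc j) (state v))) ∎
  where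
  open ≡-Reasoning
  a≤j : above a v ≤ suc j
  a≤j = subst (above a v ≤_) eq (above-antitone (ℕₚ.<⇒≤ b<a) v)
  j≤len : suc j ≤ length (state v)
  j≤len = subst (_≤ length (state v)) eq
    (noAscentAbove⇒above≤ b v b∉v v! (¬Ascents₃-⊆ (b ∷ʳ ⊆-refl) av) (¬Ascents₃⇒NoAscentAbove b v av))

All-drop-snoc⁻ : ∀ {P : ℕ → Set} n s {y} → All P (drop n (s ++ [ y ])) → All P (drop n s)
All-drop-snoc⁻ zero    s       ps = Allₚ.++⁻ˡ s ps
All-drop-snoc⁻ (suc n) []      ps = []
All-drop-snoc⁻ (suc n) (x ∷ s) ps = All-drop-snoc⁻ n s ps

-- Entries run from right to left, so `drop S` keeps the letters above a that have S more behind
-- them; the first letter of σ₂ is among these, with r low letters in front.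
lowHigh⇒ : ∀ {r S a} v → LowHigh r (suc S) a v → ¬ All (_< r) (drop S (lowsBefore a v))
lowHigh⇒ {S = S} {a} v ([] , σ₂ , σ⊆v , refl , len₂ , _ , σ₂>) few with drop S (lowsBefore a v) in eq | few
... | _ ∷ _ | () ∷ _
... | []    | _ = ℕₚ.<⇒≢ (ℕₚ.m<n⇒0<n∸m S<) (sym (trans (sym (length-drop S (lowsBefore a v))) (cong length eq)))
  where
  S< : S < length (lowsBefore a v)
  S< = subst₂ _≤_ len₂ (sym (length-lowsBefore a v)) (above-⊆ v σ⊆v σ₂>)
lowHigh⇒ {r} {S} {a} (b ∷ v) (x ∷ σ₁ , σ₂ , b ∷ʳ σ⊆v , len₁ , len₂ , σ₁< , σ₂>) few with a <ᵇ b
... | true  = lowHigh⇒ v (x ∷ σ₁ , σ₂ , σ⊆v , len₁ , len₂ , σ₁< , σ₂>) (All-drop-snoc⁻ S (lowsBefore a v) few)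
... | false = lowHigh⇒ v (x ∷ σ₁ , σ₂ , σ⊆v , len₁ , len₂ , σ₁< , σ₂>)
  (All.map ℕₚ.<⇒≤ (Allₚ.map⁻ (subst (All (_< r)) (drop-map S (lowsBefore a v)) few)))
lowHigh⇒ {suc r} {S} {a} (b ∷ v) (b ∷ σ₁ , σ₂ , refl ∷ σ⊆v , len₁ , len₂ , b<a ∷ σ₁< , σ₂>) few
  rewrite ≤⇒<ᵇ≡false (ℕₚ.<⇒≤ b<a) = lowHigh⇒ v (σ₁ , σ₂ , σ⊆v , ℕₚ.suc-injective len₁ , len₂ , σ₁< , σ₂>)
  (All.map ℕ.s≤s⁻¹ (Allₚ.map⁻ (subst (All (_< suc r)) (drop-map S (lowsBefore a v)) few)))

Any-drop-[] : ∀ {P : ℕ → Set} n → ¬ Any P (drop n [])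
Any-drop-[] {P} n p with () ← subst (Any P) (drop-[] n) p

lowHigh⇐ : ∀ {r S a} v → All (a ≢_) v → Any (r ≤_) (drop S (lowsBefore a v)) → LowHigh r (suc S) a v
lowHigh⇐ {zero} {S} {a} v _ many with above-witness {a} v (suc S) (subst (suc S ≤_) (length-lowsBefore a v) (nonempty S (lowsBefore a v) many))
  where
  nonempty : ∀ n s → Any (0 ≤_) (drop n s) → suc n ≤ length s
  nonempty zero    (x ∷ s) _ = s≤s z≤n
  nonempty (suc n) (x ∷ s) p = s≤s (nonempty n s p)
... | σ , σ⊆v , len , σ> = [] , σ , σ⊆v , refl , len , [] , σ>
lowHigh⇐ {suc r} {S} []      _           many = contradiction many (Any-drop-[] S)
lowHigh⇐ {suc r} {S} {a} (b ∷ v) (a≢b ∷ a∉v) many with ℕₚ.<-cmp a b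
... | tri≈ _ a≡b _ = contradiction a≡b a≢b
... | tri< a<b _ _ rewrite <⇒<ᵇ≡true a<b with lowHigh⇐ v a∉v (unsnoc S (lowsBefore a v) many)
  where
  -- The threshold is positive, so the entry 0 contributed by b is never the witness.
  unsnoc : ∀ n s → Any (suc r ≤_) (drop n (s ++ [ 0 ])) → Any (suc r ≤_) (drop n s)
  unsnoc zero    s       p with Anyₚ.++⁻ s p
  ... | inj₁ q         = q
  ... | inj₂ (here ())
  unsnoc (suc n) []      p = contradiction p (Any-drop-[] n)
  unsnoc (suc n) (x ∷ s) p = unsnoc n s p
... | σ₁ , σ₂ , σ⊆v , rest = σ₁ , σ₂ , b ∷ʳ σ⊆v , rest
lowHigh⇐ {suc r} {S} {a} (b ∷ v) (a≢b ∷ a∉v) many | tri> _ _ b<a rewrite ≤⇒<ᵇ≡false (ℕₚ.<⇒≤ b<a)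
  with lowHigh⇐ v a∉v (Any.map ℕ.s≤s⁻¹ (Anyₚ.map⁻ (subst (Any (suc r ≤_)) (drop-map S (lowsBefore a v)) many)))
... | σ₁ , σ₂ , σ⊆v , len₁ , len₂ , σ₁< , σ₂> = b ∷ σ₁ , σ₂ , refl ∷ σ⊆v , cong suc len₁ , len₂ , b<a ∷ σ₁< , σ₂>

module _ (S L : ℕ) where
  open Codes S L

  Avoids : List ℕ → Set
  Avoids v = ¬ Ascents₃ v × ¬ PivotedLowHigh L (suc S) v

  -- New occurrences use the first letter a, as the smallest letter of 123 or as the pivot.
  -- Excluding them means `NoAscentAbove` and a bound on `lowsBefore`, and both can be read off the
  -- state.
  avoids⇒good : ∀ v → Unique v → Avoids v → T (good v)
  avoids⇒good []      _          _             = tt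
  avoids⇒good (a ∷ v) (a∉v ∷ v!) (no-asc , no-piv) = Equivalence.from 𝔹ₚ.T-∧
    ( avoids⇒good v v! (no-asc-v , λ (b , σ₁ , σ₂ , σ⊆v , rest) → no-piv (b , σ₁ , σ₂ , a ∷ʳ σ⊆v , rest))
    , Equivalence.from 𝔹ₚ.T-∧
      ( ℕₚ.≤⇒≤ᵇ (noAscentAbove⇒above≤ a v a∉v v! no-asc-v flat)
      , subst (λ s → T (all (_<ᵇ L) (drop S s))) (lowsBefore-state a v a∉v v! no-asc-v flat) few))
    where
    no-asc-v = ¬Ascents₃-⊆ (a ∷ʳ ⊆-refl) no-asc
    flat     = ¬Ascents₃⇒NoAscentAbove a v no-asc
    few : T (all (_<ᵇ L) (drop S (lowsBefore a v)))
    few with all (_<ᵇ L) (drop S (lowsBefore a v)) in eq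
    ... | true  = tt
    ... | false = no-piv (pivot (lowHigh⇐ v a∉v (many (drop S (lowsBefore a v)) eq)))
      where
      many : ∀ s → all (_<ᵇ L) s ≡ false → Any (L ≤_) s
      many (x ∷ s) eq with x <ᵇ L in lt
      ... | true  = there (many s eq)
      ... | false = here (ℕₚ.≮⇒≥ λ x<L → subst T lt (ℕₚ.<⇒<ᵇ x<L))
      pivot : LowHigh L (suc S) a v → PivotedLowHigh L (suc S) (a ∷ v)
      pivot (σ₁ , σ₂ , σ⊆v , rest) = a , σ₁ , σ₂ , refl ∷ σ⊆v , rest

  good⇒avoids : ∀ v → Unique v → T (good v) → Avoids v
  good⇒avoids []      _          _  = (λ { (_ , _ , _ , () , _) }) , λ { (_ , _ , _ , () , _) }
  good⇒avoids (a ∷ v) (a∉v ∷ v!) ok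
    with Equivalence.to (𝔹ₚ.T-∧ {good v}) ok
  ... | ok-v , adm with good⇒avoids v v! ok-v | Equivalence.to (𝔹ₚ.T-∧ {above a v ≤ᵇ length (state v)}) adm
  ... | no-asc , no-piv | ≤len , few = no-asc′ , no-piv′
    where
    flat : NoAscentAbove a v
    flat = above≤⇒noAscentAbove a v a∉v v! no-asc (ℕₚ.≤ᵇ⇒≤ _ _ ≤len)
    few′ : All (_< L) (drop S (lowsBefore a v))
    few′ = subst (λ s → All (_< L) (drop S s)) (sym (lowsBefore-state a v a∉v v! no-asc flat))
      (All.map (λ {x} → ℕₚ.<ᵇ⇒< x L) (Allₚ.all⁺ (_<ᵇ L) _ few))
    no-asc′ : ¬ Ascents₃ (a ∷ v)
    no-asc′ (x , y , z , a ∷ʳ xyz⊆v   , x<y , y<z) = no-asc (x , y , z , xyz⊆v , x<y , y<z)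
    no-asc′ (x , y , z , refl ∷ yz⊆v , x<y , y<z) = noAscentAbove⁻ v flat yz⊆v x<y y<z
    no-piv′ : ¬ PivotedLowHigh L (suc S) (a ∷ v)
    no-piv′ (b , σ₁ , σ₂ , a ∷ʳ σ⊆v   , rest) = no-piv (b , σ₁ , σ₂ , σ⊆v , rest)
    no-piv′ (b , σ₁ , σ₂ , refl ∷ σ⊆v , rest) = lowHigh⇒ v (σ₁ , σ₂ , σ⊆v , rest) few′

module _ {R : ℕ → ℕ → Set} where

  pairs⇒AllPairs : ∀ σ → (∀ {x y} → x ∷ y ∷ [] ⊆ σ → R x y) → AllPairs R σ
  pairs⇒AllPairs []      _ = []
  pairs⇒AllPairs (x ∷ σ) r = All.tabulate (λ y∈σ → r (refl ∷ from∈ y∈σ)) ∷ pairs⇒AllPairs σ (λ xy⊆σ → r (x ∷ʳ xy⊆σ))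

  AllPairs⇒pairs : ∀ {v x y} → AllPairs R v → x ∷ y ∷ [] ⊆ v → R x y
  AllPairs⇒pairs (_ ∷ rs) (_ ∷ʳ xy⊆v)  = AllPairs⇒pairs rs xy⊆v
  AllPairs⇒pairs (r ∷ _)  (refl ∷ y⊆v) = All.head (Sublistₚ.All-resp-⊆ y⊆v r)

-- An ascent among the low letters extends to 123 by the high letter z, an ascent among the high
-- letters by the pivot a in front.
pivotedLowHigh-Contains : ∀ {r s v} → Unique v → ¬ Ascents₃ v → PivotedLowHigh r (suc s) v → Contains (w (suc r ∷ suc s ∷ [])) v
pivotedLowHigh-Contains {v = v} v! no-asc (a , σ₁ , σ₂@(z ∷ _) , σ⊆v , len₁ , len₂ , σ₁< , σ₂>@(a<z ∷ _)) =
  Contains-2-layers⇐ (a , σ₁ , σ₂ , σ⊆v , len₁ , len₂ , σ₁< , σ₂> , pairs⇒AllPairs σ₁ low , pairs⇒AllPairs σ₂ high)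
  where
  >-of : ∀ {x y} → x ∷ y ∷ [] ⊆ v → ¬ x < y → x > y
  >-of {x} {y} xy⊆v x≮y with ℕₚ.<-cmp x y
  ... | tri< x<y _ _ = contradiction x<y x≮y
  ... | tri≈ _ x≡y _ = contradiction x≡y (AllPairs⇒pairs v! xy⊆v)
  ... | tri> _ _ x>y = x>y
  low : ∀ {x y} → x ∷ y ∷ [] ⊆ σ₁ → x > y
  low {x} {y} xy⊆σ₁ = >-of (⊆-trans (a ∷ʳ Sublistₚ.++⁺ʳ σ₂ xy⊆σ₁) σ⊆v) λ x<y →
    no-asc (x , y , z , ⊆-trans (a ∷ʳ Sublistₚ.++⁺ xy⊆σ₁ (refl ∷ Sublistₚ.[]⊆-universal _)) σ⊆v
           , x<y , ℕₚ.<-trans (All.head (All.tail (Sublistₚ.All-resp-⊆ xy⊆σ₁ σ₁<))) a<z)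
  high : ∀ {x y} → x ∷ y ∷ [] ⊆ σ₂ → x > y
  high {x} {y} xy⊆σ₂ = >-of (⊆-trans (a ∷ʳ Sublistₚ.++⁺ˡ σ₁ xy⊆σ₂) σ⊆v) λ x<y →
    no-asc (a , x , y , ⊆-trans (refl ∷ Sublistₚ.++⁺ˡ σ₁ xy⊆σ₂) σ⊆v
           , All.head (Sublistₚ.All-resp-⊆ xy⊆σ₂ σ₂>) , x<y)

-- From Boolean tests to counts

avoidsAllᵇ-⇔ : ∀ τ v → T (avoidsAllᵇ (p123 ∷ τ ∷ []) v) ⇔ (¬ Ascents₃ v × ¬ Contains τ v)
avoidsAllᵇ-⇔ τ v = mk⇔ to from
  where
  to : T (avoidsAllᵇ (p123 ∷ τ ∷ []) v) → ¬ Ascents₃ v × ¬ Contains τ v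
  to av with containsᵇ p123 v in eq₁ | containsᵇ τ v in eq₂
  ... | false | false = (λ asc → subst T eq₁ (Contains⇒containsᵇ (Contains-123⇐ asc))) , (λ c → subst T eq₂ (Contains⇒containsᵇ c))
  from : ¬ Ascents₃ v × ¬ Contains τ v → T (avoidsAllᵇ (p123 ∷ τ ∷ []) v)
  from (no-asc , no-τ) with containsᵇ p123 v in eq₁ | containsᵇ τ v in eq₂
  ... | true  | _     = no-asc (Contains-123⇒ (containsᵇ⇒Contains p123 v (subst T (sym eq₁) tt)))
  ... | false | true  = no-τ (containsᵇ⇒Contains τ v (subst T (sym eq₂) tt))
  ... | false | false = tt

T-⇔⇒≡ : ∀ {b c} → (T b → T c) → (T c → T b) → b ≡ c
T-⇔⇒≡ {true}  {true}  _ _ = refl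
T-⇔⇒≡ {true}  {false} f _ with () ← f tt
T-⇔⇒≡ {false} {true}  _ g with () ← g tt
T-⇔⇒≡ {false} {false} _ _ = refl

distinctᵇ⇒Unique : ∀ v → T (distinctᵇ v) → Unique v
distinctᵇ⇒Unique []      _ = []
distinctᵇ⇒Unique (x ∷ v) d = let fresh , rest = Equivalence.to (𝔹ₚ.T-∧ {all (x ≢ᵇ_) v}) d in
  All.map (λ {y} → differ y) (Allₚ.all⁺ (x ≢ᵇ_) v fresh) ∷ distinctᵇ⇒Unique v rest
  where
  differ : ∀ y → T (x ≢ᵇ y) → x ≢ y
  differ y neq refl with x ≡ᵇ x | ℕₚ.≡⇒≡ᵇ x x refl
  differ y ()  refl | true | _

Unique⇒distinctᵇ : ∀ {v} → Unique v → T (distinctᵇ v)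
Unique⇒distinctᵇ []         = tt
Unique⇒distinctᵇ {x ∷ v} (x∉v ∷ v!) = Equivalence.from 𝔹ₚ.T-∧ (Allₚ.all⁻ (x ≢ᵇ_) (All.map (λ {y} → differ y) x∉v) , Unique⇒distinctᵇ v!)
  where
  differ : ∀ y → x ≢ y → T (x ≢ᵇ y)
  differ y x≢y with x ≡ᵇ y in eq
  ... | true  = x≢y (ℕₚ.≡ᵇ⇒≡ x y (subst T (sym eq) tt))
  ... | false = tt

perms-unique : ∀ n → All Unique (perms n)
perms-unique n = All.map (λ {v} → distinctᵇ⇒Unique v) (Allₚ.all-filter (T? ∘ distinctᵇ) (words n n))

avoidCount-cong : ∀ T₁ n {p : List ℕ → Bool} → All (λ v → avoidsAllᵇ T₁ v ≡ p v) (perms n) →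
  avoidCount T₁ n ≡ length (filterᵇ p (perms n))
avoidCount-cong T₁ n eqs = cong length (filterᵇ-cong eqs)

avoidCount-2-layers : ∀ L S n → avoidCount (p123 ∷ w (suc L ∷ suc S ∷ []) ∷ []) n ≡ ballot (S + suc (suc L)) 0 n
avoidCount-2-layers L S n = trans (avoidCount-cong (p123 ∷ τ ∷ []) n (All.map (λ {v} → same v) (perms-unique n))) (count-good n)
  where
  open Codes S L
  τ = w (suc L ∷ suc S ∷ [])
  same : ∀ v → Unique v → avoidsAllᵇ (p123 ∷ τ ∷ []) v ≡ good v
  same v v! = T-⇔⇒≡
    (λ av → let no-asc , no-τ = Equivalence.to (avoidsAllᵇ-⇔ τ v) av in
      avoids⇒good S L v v! (no-asc , λ piv → no-τ (pivotedLowHigh-Contains v! no-asc piv)))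
    (λ ok → let no-asc , no-piv = good⇒avoids S L v v! ok in
      Equivalence.from (avoidsAllᵇ-⇔ τ v) (no-asc , λ c → no-piv (Contains-2-layers⇒ c)))

-- Only the pattern 123 matters, and on words of length n it is unaffected by adding w(1,n+1).
avoidCount-ascents : ∀ τ n → Ascents₃ τ → avoidCount (p123 ∷ τ ∷ []) n ≡ catalan n
avoidCount-ascents τ n asc = trans
  (trans (avoidCount-cong (p123 ∷ τ ∷ []) n (All.map (λ {v} → same v) (perms-length n)))
         (avoidCount-2-layers 0 n n))
  (ballot-catalan (n + 2) n (subst (n <_) (ℕₚ.+-comm 2 n) (ℕₚ.m≤n⇒m≤1+n (ℕₚ.n<1+n n))))
  where
  long = w (1 ∷ suc n ∷ [])
  too-short : ∀ v → length v ≡ n → ¬ Contains long v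
  too-short v len c with Contains-2-layers⇒ {0} {suc n} c
  ... | a , σ₁ , σ₂ , σ⊆v , _ , len₂ , _ = ℕₚ.<⇒≱ (ℕₚ.n<1+n n) (begin
    suc n                   ≡⟨ len₂ ⟨
    length σ₂               ≤⟨ Sublistₚ.length-mono-≤ (a ∷ʳ Sublistₚ.++⁺ˡ σ₁ ⊆-refl) ⟩
    length (a ∷ σ₁ ++ σ₂)   ≤⟨ Sublistₚ.length-mono-≤ σ⊆v ⟩
    length v                ≡⟨ len ⟩
    n                       ∎)
    where open ℕₚ.≤-Reasoning
  same : ∀ v → length v ≡ n → avoidsAllᵇ (p123 ∷ τ ∷ []) v ≡ avoidsAllᵇ (p123 ∷ long ∷ []) v
  same v len = T-⇔⇒≡
    (λ av → Equivalence.from (avoidsAllᵇ-⇔ long v) (proj₁ (Equivalence.to (avoidsAllᵇ-⇔ τ v) av) , too-short v len))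
    (λ av → let no-asc = proj₁ (Equivalence.to (avoidsAllᵇ-⇔ long v) av) in
      Equivalence.from (avoidsAllᵇ-⇔ τ v) (no-asc , λ c → no-asc (Contains-ascents⇒ asc c)))

-- Patterns with one layer

-- The left-to-right minima of c ∷ v (σ₁) and the remaining letters (σ₂) both decrease.
minima-split : ∀ c v → Unique (c ∷ v) → ¬ Ascents₃ (c ∷ v) → ∃₂ λ σ₁ σ₂ →
  σ₁ ⊆ v × σ₂ ⊆ v × length σ₁ + length σ₂ ≡ length v × Decreasing (c ∷ σ₁) × Decreasing σ₂
minima-split c []      _                         _      = [] , [] , [] , [] , refl , [] ∷ [] , []
minima-split c (x ∷ v) ((c≢x ∷ c∉v) ∷ x∉v ∷ v!) no-asc with ℕₚ.<-cmp x c
... | tri≈ _ x≡c _ = contradiction (sym x≡c) c≢x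
... | tri< x<c _ _ with minima-split x v (x∉v ∷ v!) (¬Ascents₃-⊆ (c ∷ʳ ⊆-refl) no-asc)
... | σ₁ , σ₂ , σ₁⊆v , σ₂⊆v , len , (σ₁<x ∷ σ₁↓) , σ₂↓ =
  x ∷ σ₁ , σ₂ , refl ∷ σ₁⊆v , x ∷ʳ σ₂⊆v , cong suc len ,
  (x<c ∷ All.map (λ y<x → ℕₚ.<-trans y<x x<c) σ₁<x) ∷ σ₁<x ∷ σ₁↓ , σ₂↓
minima-split c (x ∷ v) ((c≢x ∷ c∉v) ∷ x∉v ∷ v!) no-asc | tri> _ _ c<x
  with minima-split c v (c∉v ∷ v!) (¬Ascents₃-⊆ (refl ∷ x ∷ʳ ⊆-refl) no-asc)
... | σ₁ , σ₂ , σ₁⊆v , σ₂⊆v , len , σ₁↓ , σ₂↓ =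
  σ₁ , x ∷ σ₂ , x ∷ʳ σ₁⊆v , refl ∷ σ₂⊆v , trans (ℕₚ.+-suc (length σ₁) (length σ₂)) (cong suc len) , σ₁↓ ,
  Sublistₚ.All-resp-⊆ σ₂⊆v (All.tabulate smaller) ∷ σ₂↓
  where
  smaller : ∀ {y} → y ∈ v → x > y
  smaller {y} y∈v with ℕₚ.<-cmp x y
  ... | tri< x<y _ _ = contradiction (c , x , y , refl ∷ refl ∷ from∈ y∈v , c<x , x<y) no-asc
  ... | tri≈ _ x≡y _ = contradiction x≡y (All.lookup x∉v y∈v)
  ... | tri> _ _ x>y = x>y

-- Pigeonhole: two decreasing sequences cover the word, and if both were shorter than k its length
-- would be at most 2(k - 1).
long-decreasing : ∀ {k v} → Unique v → ¬ Ascents₃ v → 2 * k ∸ 2 < length v → ∃ λ σ → σ ⊆ v × Decreasing σ × length σ ≡ k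
long-decreasing {k} {c ∷ v} v! no-asc long with minima-split c v v! no-asc
... | σ₁ , σ₂ , σ₁⊆v , σ₂⊆v , len , σ₁↓ , σ₂↓ with ℕₚ.≤-<-connex k (suc (length σ₁)) | ℕₚ.≤-<-connex k (length σ₂)
... | inj₁ k≤ | _ = truncate (c ∷ σ₁) (refl ∷ σ₁⊆v) σ₁↓ k≤
  where
  truncate : ∀ σ → σ ⊆ c ∷ v → Decreasing σ → k ≤ length σ → ∃ λ σ → σ ⊆ c ∷ v × Decreasing σ × length σ ≡ k
  truncate σ σ⊆ σ↓ k≤ = take k σ , ⊆-trans (Sublistₚ.take-⊆ k σ) σ⊆ , AllPairsₚ.take⁺ k σ↓ ,
    trans (length-take k σ) (ℕₚ.m≤n⇒m⊓n≡m k≤)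
... | inj₂ _ | inj₁ k≤ = take k σ₂ , ⊆-trans (Sublistₚ.take-⊆ k σ₂) (c ∷ʳ σ₂⊆v) , AllPairsₚ.take⁺ k σ₂↓ ,
  trans (length-take k σ₂) (ℕₚ.m≤n⇒m⊓n≡m k≤)
... | inj₂ <k₁ | inj₂ <k₂ = contradiction long (ℕₚ.≤⇒≯ (begin
    suc (length v)                            ≡⟨ cong suc len ⟨
    suc (length σ₁ + length σ₂)               ≡⟨ ℕₚ.+-suc (length σ₁) (length σ₂) ⟨
    suc (suc (length σ₁)) + suc (length σ₂) ∸ 2 ≤⟨ ℕₚ.∸-monoˡ-≤ 2 (ℕₚ.+-mono-≤ <k₁ <k₂) ⟩
    k + k ∸ 2                                 ≡⟨ cong (λ k′ → k + k′ ∸ 2) (ℕₚ.+-identityʳ k) ⟨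
    2 * k ∸ 2                                 ∎))
  where open ℕₚ.≤-Reasoning

avoidCount-1-layer-vanishes : ∀ k n → 2 * k ∸ 2 < n → avoidCount (p123 ∷ w (k ∷ []) ∷ []) n ≡ 0
avoidCount-1-layer-vanishes k n large = trans
  (avoidCount-cong (p123 ∷ w (k ∷ []) ∷ []) n {λ _ → false}
    (All.zipWith (λ {v} (v! , len) → none v v! len) (perms-unique n , perms-length n)))
  (cong length (filter-none (perms n)))
  where
  filter-none : ∀ (vs : List (List ℕ)) → filterᵇ (λ _ → false) vs ≡ []
  filter-none []       = refl
  filter-none (v ∷ vs) = filter-none vs
  none : ∀ v → Unique v → length v ≡ n → avoidsAllᵇ (p123 ∷ w (k ∷ []) ∷ []) v ≡ false
  none v v! refl = T-⇔⇒≡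
    (λ av → let no-asc , no-τ = Equivalence.to (avoidsAllᵇ-⇔ (w (k ∷ [])) v) av in
      no-τ (Contains-1-layer⇐ (long-decreasing v! no-asc large)))
    λ ()

∈-words : ∀ {n} v → All (_< n) v → v ∈ words n (length v)
∈-words []      []          = here refl
∈-words {n} (x ∷ v) (x<n ∷ v<n) =
  ∈-concatMap⁺ (λ a → map (a ∷_) (words n (length v)))
    (Any.map (λ { refl → ∈-map⁺ (x ∷_) (∈-words v v<n) }) (∈-upTo⁺ x<n))

⊆-++⁻ : ∀ {σ : List ℕ} xs {ys} → σ ⊆ xs ++ ys → ∃₂ λ σ₁ σ₂ → σ ≡ σ₁ ++ σ₂ × σ₁ ⊆ xs × σ₂ ⊆ ys
⊆-++⁻ []       σ⊆          = [] , _ , refl , [] , σ⊆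
⊆-++⁻ (x ∷ xs) (x ∷ʳ σ⊆)   = let σ₁ , σ₂ , eq , σ₁⊆ , σ₂⊆ = ⊆-++⁻ xs σ⊆ in σ₁ , σ₂ , eq , x ∷ʳ σ₁⊆ , σ₂⊆
⊆-++⁻ (x ∷ xs) (refl ∷ σ⊆) = let σ₁ , σ₂ , eq , σ₁⊆ , σ₂⊆ = ⊆-++⁻ xs σ⊆ in x ∷ σ₁ , σ₂ , cong (x ∷_) eq , refl ∷ σ₁⊆ , σ₂⊆

-- The extremal permutation is w(m,m) with m = k − 1.
module TwoEqualLayers (m : ℕ) where

  low high witness : List ℕ
  low     = map (λ x → 0 + x) (downFrom m)
  high    = map (λ x → m + x) (downFrom m)
  witness = low ++ high

  low<m : All (_< m) low
  low<m = All.map proj₂ (layer-bounds 0 m)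

  m≤high : All (m ≤_) high
  m≤high = All.map proj₁ (layer-bounds m m)

  Between : ℕ → ℕ → Set
  Between x y = x > y ⊎ (x < m × m ≤ y)

  witness-between : AllPairs Between witness
  witness-between = AllPairsₚ.++⁺
    (AllPairs.map inj₁ (layer-decreasing 0 m)) (AllPairs.map inj₁ (layer-decreasing m m))
    (All.map (λ x<m → All.map (λ m≤y → inj₂ (x<m , m≤y)) m≤high) low<m)

  length-witness : length witness ≡ m + m
  length-witness = trans (length-++ low) (cong₂ _+_ (length-layer 0 m) (length-layer m m))

  witness∈perms : witness ∈ perms (m + m)
  witness∈perms = ∈-filter⁺ (T? ∘ distinctᵇ)
    (subst (λ l → witness ∈ words (m + m) l) length-witness
      (∈-words witness (Allₚ.++⁺ (All.map (λ x<m → ℕₚ.≤-trans x<m (ℕₚ.m≤m+n m m)) low<m)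
                                  (All.map proj₂ (layer-bounds m m)))))
    (Unique⇒distinctᵇ (AllPairs.map between⇒≢ witness-between))
    where
    between⇒≢ : ∀ {x y} → Between x y → x ≢ y
    between⇒≢ (inj₁ x>y)         refl = ℕₚ.<-irrefl refl x>y
    between⇒≢ (inj₂ (x<m , m≤x)) refl = ℕₚ.<⇒≱ x<m m≤x

  -- An ascent leads from the low layer to the high one, so its upper end cannot begin another.
  ¬Ascents₃-witness : ¬ Ascents₃ witness
  ¬Ascents₃-witness (x , y , z , xyz⊆ , x<y , y<z)
    with AllPairs⇒pairs witness-between (⊆-trans (refl ∷ refl ∷ z ∷ʳ []) xyz⊆)
       | AllPairs⇒pairs witness-between (⊆-trans (x ∷ʳ ⊆-refl) xyz⊆)
  ... | inj₁ x>y       | _              = ℕₚ.<-asym x<y x>y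
  ... | inj₂ _         | inj₁ y>z       = ℕₚ.<-asym y<z y>z
  ... | inj₂ (_ , m≤y) | inj₂ (y<m , _) = ℕₚ.<⇒≱ y<m m≤y

  decreasing-short : ∀ {σ} → σ ⊆ witness → Decreasing σ → length σ ≤ m
  decreasing-short σ⊆ σ↓ with ⊆-++⁻ low σ⊆
  ... | []     , σ₂     , refl , _   , σ₂⊆ = subst (length σ₂ ≤_) (length-layer m m) (Sublistₚ.length-mono-≤ σ₂⊆)
  ... | σ₁@(_ ∷ _) , [] , refl , σ₁⊆ , _   = subst₂ _≤_ (cong length (sym (++-identityʳ σ₁))) (length-layer 0 m) (Sublistₚ.length-mono-≤ σ₁⊆)
  ... | x ∷ σ₁ , y ∷ σ₂ , refl , σ₁⊆ , σ₂⊆ = contradiction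
    (AllPairs⇒pairs σ↓ (refl ∷ Sublistₚ.++⁺ˡ σ₁ (refl ∷ Sublistₚ.[]⊆-universal σ₂)))
    (ℕₚ.<⇒≯ (ℕₚ.<-≤-trans (All.head (Sublistₚ.All-resp-⊆ σ₁⊆ low<m)) (All.head (Sublistₚ.All-resp-⊆ σ₂⊆ m≤high))))

avoidCount-1-layer-nonzero : ∀ m → avoidCount (p123 ∷ w (suc m ∷ []) ∷ []) (2 * suc m ∸ 2) ≢ 0
avoidCount-1-layer-nonzero m =
  subst (λ n → avoidCount (p123 ∷ w (suc m ∷ []) ∷ []) n ≢ 0) (sym size) (nonempty
    (∈-filter⁺ (T? ∘ avoidsAllᵇ (p123 ∷ w (suc m ∷ []) ∷ [])) witness∈perms
      (Equivalence.from (avoidsAllᵇ-⇔ (w (suc m ∷ [])) witness) (¬Ascents₃-witness , no-layer))))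
  where
  open TwoEqualLayers m
  size : 2 * suc m ∸ 2 ≡ m + m
  size = trans (cong (_∸ 1) (ℕₚ.+-suc m (m + 0))) (cong (m +_) (ℕₚ.+-identityʳ m))
  nonempty : ∀ {v : List ℕ} {vs} → v ∈ vs → length vs ≢ 0
  nonempty (here _)  ()
  nonempty (there _) ()
  no-layer : ¬ Contains (w (suc m ∷ [])) witness
  no-layer c with Contains-1-layer⇒ {suc m} c
  ... | σ , σ⊆ , σ↓ , len = ℕₚ.<⇒≱ (ℕₚ.n<1+n m) (subst (_≤ m) len (decreasing-short σ⊆ σ↓))

-- Chebyshev polynomials

open import Data.Integer using (ℤ; +_; -_) renaming (_+_ to _+ℤ_; _*_ to _*ℤ_; _-_ to _-ℤ_)
import Data.Integer.Properties as ℤₚ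
open import Data.Integer.Tactic.RingSolver using () renaming (solve-∀ to solve-∀ℤ)

-- The local recursion of conv has no name outside Defs; abstracting suc m in an
-- unfolded instance makes unification recover it as the value of partialConv.
mutual
  partialConv : (ℕ → ℤ) → (ℕ → ℤ) → ℕ → ℕ → ℤ
  partialConv = _

  conv-unfold : ∀ f g m → conv f g (suc m) ≡
    f (suc m) *ℤ g (m ∸ m) +ℤ (f m *ℤ g (suc m ∸ m) +ℤ partialConv f g (suc m) m)
  conv-unfold f g m with suc m
  ... | w = refl

-- Formal power series in t

PowerSeries : Set
PowerSeries = ℕ → ℤ

infix 4 _≋_
_≋_ : PowerSeries → PowerSeries → Set
f ≋ g = ∀ m → f m ≡ g m

infixl 6 _⊕_
_⊕_ : PowerSeries → PowerSeries → PowerSeries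
(f ⊕ g) m = f m +ℤ g m

infixl 7 _⊙_
_⊙_ : ℤ → PowerSeries → PowerSeries
(c ⊙ f) m = c *ℤ f m

shift : PowerSeries → PowerSeries
shift f zero    = + 0
shift f (suc m) = f m

one : PowerSeries
one zero    = + 1
one (suc m) = + 0

shift-cong : ∀ {f g} → f ≋ g → shift f ≋ shift g
shift-cong eq zero    = refl
shift-cong eq (suc m) = eq m

partialConv-cong : ∀ {f f′ g g′} → f ≋ f′ → g ≋ g′ → ∀ m i → partialConv f g m i ≡ partialConv f′ g′ m i
partialConv-cong f≋ g≋ m zero    = refl
partialConv-cong f≋ g≋ m (suc i) =
  cong₂ _+ℤ_ (cong₂ _*ℤ_ (f≋ i) (g≋ (m ∸ i))) (partialConv-cong f≋ g≋ m i)

conv-cong : ∀ {f f′ g g′} → f ≋ f′ → g ≋ g′ → conv f g ≋ conv f′ g′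
conv-cong f≋ g≋ m = partialConv-cong f≋ g≋ m (suc m)

partialConv-⊕ˡ : ∀ f f′ g m i → partialConv (f ⊕ f′) g m i ≡ partialConv f g m i +ℤ partialConv f′ g m i
partialConv-⊕ˡ f f′ g m zero    = refl
partialConv-⊕ˡ f f′ g m (suc i) rewrite partialConv-⊕ˡ f f′ g m i =
  distribute (f i) (f′ i) (g (m ∸ i)) (partialConv f g m i) (partialConv f′ g m i)
  where
  distribute : ∀ a a′ b p q → (a +ℤ a′) *ℤ b +ℤ (p +ℤ q) ≡ (a *ℤ b +ℤ p) +ℤ (a′ *ℤ b +ℤ q)
  distribute = solve-∀ℤ

conv-⊕ˡ : ∀ f f′ g → conv (f ⊕ f′) g ≋ conv f g ⊕ conv f′ g
conv-⊕ˡ f f′ g m = partialConv-⊕ˡ f f′ g m (suc m)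

partialConv-⊕ʳ : ∀ f g g′ m i → partialConv f (g ⊕ g′) m i ≡ partialConv f g m i +ℤ partialConv f g′ m i
partialConv-⊕ʳ f g g′ m zero    = refl
partialConv-⊕ʳ f g g′ m (suc i) rewrite partialConv-⊕ʳ f g g′ m i =
  distribute (f i) (g (m ∸ i)) (g′ (m ∸ i)) (partialConv f g m i) (partialConv f g′ m i)
  where
  distribute : ∀ a b b′ p q → a *ℤ (b +ℤ b′) +ℤ (p +ℤ q) ≡ (a *ℤ b +ℤ p) +ℤ (a *ℤ b′ +ℤ q)
  distribute = solve-∀ℤ

conv-⊕ʳ : ∀ f g g′ → conv f (g ⊕ g′) ≋ conv f g ⊕ conv f g′
conv-⊕ʳ f g g′ m = partialConv-⊕ʳ f g g′ m (suc m)

partialConv-⊙ʳ : ∀ c f g m i → partialConv f (c ⊙ g) m i ≡ c *ℤ partialConv f g m i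
partialConv-⊙ʳ c f g m zero    = sym (ℤₚ.*-zeroʳ c)
partialConv-⊙ʳ c f g m (suc i) rewrite partialConv-⊙ʳ c f g m i =
  distribute c (f i) (g (m ∸ i)) (partialConv f g m i)
  where
  distribute : ∀ c a b p → a *ℤ (c *ℤ b) +ℤ c *ℤ p ≡ c *ℤ (a *ℤ b +ℤ p)
  distribute = solve-∀ℤ

conv-⊙ʳ : ∀ c f g → conv f (c ⊙ g) ≋ c ⊙ conv f g
conv-⊙ʳ c f g m = partialConv-⊙ʳ c f g m (suc m)

partialConv-shiftˡ : ∀ f g m i → partialConv (shift f) g (suc m) (suc i) ≡ partialConv f g m i
partialConv-shiftˡ f g m zero    = refl
partialConv-shiftˡ f g m (suc i) = cong (f i *ℤ g (m ∸ i) +ℤ_) (partialConv-shiftˡ f g m i)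

conv-shiftˡ : ∀ f g → conv (shift f) g ≋ shift (conv f g)
conv-shiftˡ f g zero    = refl
conv-shiftˡ f g (suc m) = partialConv-shiftˡ f g m (suc m)

partialConv-shiftʳ : ∀ f g m i → i ≤ suc m → partialConv f (shift g) (suc m) i ≡ partialConv f g m i
partialConv-shiftʳ f g m zero    _ = refl
partialConv-shiftʳ f g m (suc i) (s≤s i≤m) rewrite ℕₚ.+-∸-assoc 1 i≤m =
  cong (f i *ℤ g (m ∸ i) +ℤ_) (partialConv-shiftʳ f g m i (ℕₚ.m≤n⇒m≤1+n i≤m))

conv-shiftʳ : ∀ f g → conv f (shift g) ≋ shift (conv f g)
conv-shiftʳ f g zero    = trans (ℤₚ.+-identityʳ _) (ℤₚ.*-zeroʳ (f 0))
conv-shiftʳ f g (suc m) = trans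
  (cong₂ _+ℤ_
    (trans (cong (λ d → f (suc m) *ℤ shift g d) (ℕₚ.n∸n≡0 m)) (ℤₚ.*-zeroʳ (f (suc m))))
    (partialConv-shiftʳ f g m (suc m) ℕₚ.≤-refl))
  (ℤₚ.+-identityˡ _)

partialConv-oneˡ : ∀ g m i → partialConv one g m (suc i) ≡ g m
partialConv-oneˡ g m zero    = trans (ℤₚ.+-identityʳ _) (ℤₚ.*-identityˡ (g m))
partialConv-oneˡ g m (suc i) = trans (ℤₚ.+-identityˡ _) (partialConv-oneˡ g m i)

conv-oneˡ : ∀ g → conv one g ≋ g
conv-oneˡ g m = partialConv-oneˡ g m m

-- Reversed Chebyshev polynomials

Ucoef-vanishes : ∀ r i → r < i → Ucoef r i ≡ + 0
Ucoef-vanishes zero          (suc i)       _ = refl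
Ucoef-vanishes (suc zero)    (suc zero)    (s≤s ())
Ucoef-vanishes (suc zero)    (suc (suc i)) _ = refl
Ucoef-vanishes (suc (suc r)) (suc i) (s≤s r<i)
  rewrite Ucoef-vanishes (suc r) i r<i
        | Ucoef-vanishes r (suc i) (ℕₚ.m≤n⇒m≤1+n (ℕₚ.<-trans (ℕₚ.n<1+n r) r<i)) = refl

scaledRevCoef-≤ : ∀ j i → scaledRevCoef (j + i) j ≡ Ucoef (j + i) i *ℤ + (2 ^ j)
scaledRevCoef-≤ j i with j + i <ᵇ j in lt
... | true  = contradiction (ℕₚ.<ᵇ⇒< (j + i) j (subst T (sym lt) tt)) (ℕₚ.≤⇒≯ (ℕₚ.m≤m+n j i))
... | false = cong (λ d → Ucoef (j + i) d *ℤ + (2 ^ j)) (ℕₚ.m+n∸m≡n j i)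

scaledRevCoef-> : ∀ {r j} → r < j → scaledRevCoef r j ≡ + 0
scaledRevCoef-> {r} {j} r<j with r <ᵇ j | ℕₚ.<⇒<ᵇ r<j
... | true | _ = refl

shift² : PowerSeries → PowerSeries
shift² f = shift (shift f)

4*2^ : ∀ n → + (2 ^ (2 + n)) ≡ + 4 *ℤ + (2 ^ n)
4*2^ n = trans (cong +_ (quadruple (2 ^ n))) (ℤₚ.pos-* 4 (2 ^ n))
  where
  quadruple : ∀ p → 2 * (2 * p) ≡ 4 * p
  quadruple p = sym (ℕₚ.*-assoc 2 2 p)

-- The three-term recurrence of the Chebyshev polynomials, with the subtraction moved to the left.
scaledRevCoef-recurrence : ∀ r →
  scaledRevCoef (2 + r) ⊕ + 4 ⊙ shift² (scaledRevCoef r) ≋ + 2 ⊙ scaledRevCoef (1 + r)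
scaledRevCoef-recurrence r zero
  rewrite Ucoef-vanishes r (2 + r) (ℕₚ.m≤n⇒m≤1+n (ℕₚ.n<1+n r)) = simplify (Ucoef (1 + r) (1 + r))
  where
  simplify : ∀ u → ((+ 2) *ℤ u -ℤ + 0) *ℤ + 1 +ℤ + 0 ≡ (+ 2) *ℤ (u *ℤ + 1)
  simplify = solve-∀ℤ
scaledRevCoef-recurrence r (suc zero)
  rewrite Ucoef-vanishes r (1 + r) (ℕₚ.n<1+n r) = simplify (Ucoef (1 + r) r)
  where
  simplify : ∀ u → ((+ 2) *ℤ u -ℤ + 0) *ℤ + 2 +ℤ + 0 ≡ (+ 2) *ℤ (u *ℤ + 2)
  simplify = solve-∀ℤ
-- With P_r = (2t)^r U_r(1/(2t)) the claim is P_{r+2} + 4t² P_r = 2 P_{r+1}. At t^(2+j) all terms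
-- vanish if r < j, the right side alone if r = j.
scaledRevCoef-recurrence r (suc (suc j)) with ℕ.compare r j
... | ℕ.less r d
  rewrite scaledRevCoef-> {2 + r} {3 + r + d} (s≤s (s≤s (s≤s (ℕₚ.m≤m+n r d))))
        | scaledRevCoef-> {1 + r} {3 + r + d} (s≤s (s≤s (ℕₚ.m≤n⇒m≤1+n (ℕₚ.m≤m+n r d))))
        | scaledRevCoef-> {r} {1 + r + d} (s≤s (ℕₚ.m≤m+n r d)) = refl
... | ℕ.equal r
  rewrite scaledRevCoef-> {1 + r} {2 + r} (ℕₚ.n<1+n (1 + r)) = begin
  scaledRevCoef (2 + r) (2 + r) +ℤ + 4 *ℤ scaledRevCoef r r
    ≡⟨ cong₂ (λ a b → a +ℤ + 4 *ℤ b) (leading (2 + r)) (leading r) ⟩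
  - Ucoef r 0 *ℤ + (2 ^ (2 + r)) +ℤ + 4 *ℤ (Ucoef r 0 *ℤ + (2 ^ r))
    ≡⟨ cong (λ p → - Ucoef r 0 *ℤ p +ℤ + 4 *ℤ (Ucoef r 0 *ℤ + (2 ^ r))) (4*2^ r) ⟩
  - Ucoef r 0 *ℤ (+ 4 *ℤ + (2 ^ r)) +ℤ + 4 *ℤ (Ucoef r 0 *ℤ + (2 ^ r))
    ≡⟨ simplify (Ucoef r 0) (+ (2 ^ r)) ⟩
  + 0 ∎
  where
  open ≡-Reasoning
  leading : ∀ r → scaledRevCoef r r ≡ Ucoef r 0 *ℤ + (2 ^ r)
  leading r = subst (λ q → scaledRevCoef q r ≡ Ucoef q 0 *ℤ + (2 ^ r)) (ℕₚ.+-identityʳ r) (scaledRevCoef-≤ r 0)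
  simplify : ∀ u p → - u *ℤ ((+ 4) *ℤ p) +ℤ + 4 *ℤ (u *ℤ p) ≡ + 0
  simplify = solve-∀ℤ
... | ℕ.greater j i = begin
  scaledRevCoef (3 + j + i) (2 + j) +ℤ + 4 *ℤ scaledRevCoef (1 + j + i) j
    ≡⟨ cong₂ (λ a b → a +ℤ + 4 *ℤ b) (at (2 + j) (1 + i) (3 + j + i) (ℕₚ.+-suc (2 + j) i))
                                      (at j (1 + i) (1 + j + i) (ℕₚ.+-suc j i)) ⟩
  (+ 2 *ℤ Ucoef (2 + j + i) i -ℤ u) *ℤ + (2 ^ (2 + j)) +ℤ + 4 *ℤ (u *ℤ + (2 ^ j))
    ≡⟨ cong (λ p → (+ 2 *ℤ Ucoef (2 + j + i) i -ℤ u) *ℤ p +ℤ + 4 *ℤ (u *ℤ + (2 ^ j))) (4*2^ j) ⟩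
  (+ 2 *ℤ Ucoef (2 + j + i) i -ℤ u) *ℤ (+ 4 *ℤ + (2 ^ j)) +ℤ + 4 *ℤ (u *ℤ + (2 ^ j))
    ≡⟨ simplify (Ucoef (2 + j + i) i) u (+ (2 ^ j)) ⟩
  + 2 *ℤ (Ucoef (2 + j + i) i *ℤ (+ 4 *ℤ + (2 ^ j)))
    ≡⟨ cong (λ p → + 2 *ℤ (Ucoef (2 + j + i) i *ℤ p)) (sym (4*2^ j)) ⟩
  + 2 *ℤ (Ucoef (2 + j + i) i *ℤ + (2 ^ (2 + j)))
    ≡⟨ cong (+ 2 *ℤ_) (sym (scaledRevCoef-≤ (2 + j) i)) ⟩
  + 2 *ℤ scaledRevCoef (2 + j + i) (2 + j) ∎
  where
  open ≡-Reasoning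
  u = Ucoef (1 + j + i) (1 + i)
  at : ∀ j i r → j + i ≡ r → scaledRevCoef r j ≡ Ucoef r i *ℤ + (2 ^ j)
  at j i _ refl = scaledRevCoef-≤ j i
  simplify : ∀ a u p → (+ 2 *ℤ a -ℤ u) *ℤ (+ 4 *ℤ p) +ℤ + 4 *ℤ (u *ℤ p) ≡ + 2 *ℤ (a *ℤ (+ 4 *ℤ p))
  simplify = solve-∀ℤ

-- Generating functions of ballot paths, t² marking an up-step

evenSpread-shift² : ∀ a n → evenSpread a (2 + n) ≡ evenSpread (λ m → a (suc m)) n
evenSpread-shift² a n = cong (λ q → if n % 2 ≡ᵇ 0 then + a q else + 0) (m/n≡1+[m∸n]/n {2 + n} {2} (s≤s (s≤s z≤n)))

evenSpread-cong : ∀ {a b} → (∀ n → a n ≡ b n) → evenSpread a ≋ evenSpread b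
evenSpread-cong eq i = cong (λ c → if i % 2 ≡ᵇ 0 then + c else + 0) (eq (i / 2))

evenSpread-+ : ∀ a b → evenSpread (λ n → a n + b n) ≋ evenSpread a ⊕ evenSpread b
evenSpread-+ a b i with i % 2 ≡ᵇ 0
... | true  = refl
... | false = refl

-- The paths from height i with room e + 1 that do not begin with an up-step; from height 0 this is
-- the empty path alone.
below : ℕ → ℕ → PowerSeries
below e zero    = one
below e (suc i) = evenSpread (ballot (suc (suc e)) i)

evenSpread-0 : ∀ i → evenSpread (λ _ → 0) i ≡ + 0
evenSpread-0 i with i % 2 ≡ᵇ 0
... | true  = refl
... | false = refl

evenSpread-ballot : ∀ e i → evenSpread (ballot (suc e) i) ≋ below e i ⊕ shift² (evenSpread (ballot e (suc i)))
evenSpread-ballot e zero    zero          = refl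
evenSpread-ballot e zero    (suc zero)    = refl
evenSpread-ballot e zero    (suc (suc n)) =
  trans (evenSpread-shift² (ballot (suc e) 0) n) (sym (ℤₚ.+-identityˡ _))
evenSpread-ballot e (suc i) zero          = refl
evenSpread-ballot e (suc i) (suc zero)    = refl
evenSpread-ballot e (suc i) (suc (suc n)) = begin
  evenSpread (ballot (suc e) (suc i)) (2 + n)
    ≡⟨ evenSpread-shift² (ballot (suc e) (suc i)) n ⟩
  evenSpread (λ m → ballot (suc (suc e)) i (suc m) + ballot e (suc (suc i)) m) n
    ≡⟨ evenSpread-+ (λ m → ballot (suc (suc e)) i (suc m)) (ballot e (suc (suc i))) n ⟩
  evenSpread (λ m → ballot (suc (suc e)) i (suc m)) n +ℤ evenSpread (ballot e (suc (suc i))) n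
    ≡⟨ cong (_+ℤ evenSpread (ballot e (suc (suc i))) n) (evenSpread-shift² (ballot (suc (suc e)) i) n) ⟨
  evenSpread (ballot (suc (suc e)) i) (2 + n) +ℤ evenSpread (ballot e (suc (suc i))) n ∎
  where open ≡-Reasoning

-- Induction on the room, for all starting heights. Let Z be the series on the left for room e + 2
-- and height i. Its part with an initial up-step involves height i + 1 and room e + 1, which the
-- induction hypothesis expresses through `below e (suc i)`, that is, through Z again; the Chebyshev
-- recurrence then cancels it.
conv-evenSpread-ballot : ∀ e i →
  conv (evenSpread (ballot (suc e) i)) (scaledRevCoef (suc e)) ≋ + 2 ⊙ conv (below e i) (scaledRevCoef e)
conv-evenSpread-ballot zero i m = begin
  conv (evenSpread (ballot 1 i)) (scaledRevCoef 1) m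
    ≡⟨ conv-cong level-0 scaledRevCoef-1 m ⟩
  conv (below 0 i) (+ 2 ⊙ scaledRevCoef 0) m
    ≡⟨ conv-⊙ʳ (+ 2) (below 0 i) (scaledRevCoef 0) m ⟩
  + 2 *ℤ conv (below 0 i) (scaledRevCoef 0) m ∎
  where
  open ≡-Reasoning
  level-0 : evenSpread (ballot 1 i) ≋ below 0 i
  level-0 zero          = trans (evenSpread-ballot 0 i 0) (ℤₚ.+-identityʳ _)
  level-0 (suc zero)    = trans (evenSpread-ballot 0 i 1) (ℤₚ.+-identityʳ _)
  level-0 (suc (suc n)) = trans (evenSpread-ballot 0 i (2 + n))
    (trans (cong (below 0 i (2 + n) +ℤ_) (evenSpread-0 n)) (ℤₚ.+-identityʳ _))
  scaledRevCoef-1 : scaledRevCoef 1 ≋ + 2 ⊙ scaledRevCoef 0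
  scaledRevCoef-1 zero          = refl
  scaledRevCoef-1 (suc zero)    = refl
  scaledRevCoef-1 (suc (suc n)) = refl
conv-evenSpread-ballot (suc e) i m = begin
  conv Z S₂ m
    ≡⟨ add-cancel _ (+ 4 *ℤ shift² (conv Z S₀) m) ⟩
  conv Z S₂ m +ℤ + 4 *ℤ shift² (conv Z S₀) m -ℤ + 4 *ℤ shift² (conv Z S₀) m
    ≡⟨ cong (_-ℤ + 4 *ℤ shift² (conv Z S₀) m) recurrenceʳ ⟩
  + 2 *ℤ conv Z S₁ m -ℤ + 4 *ℤ shift² (conv Z S₀) m
    ≡⟨ cong (λ c → + 2 *ℤ c -ℤ + 4 *ℤ shift² (conv Z S₀) m) recurrenceˡ ⟩
  + 2 *ℤ (conv B S₁ m +ℤ + 2 *ℤ shift² (conv Z S₀) m) -ℤ + 4 *ℤ shift² (conv Z S₀) m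
    ≡⟨ simplify (conv B S₁ m) (shift² (conv Z S₀) m) ⟩
  + 2 *ℤ conv B S₁ m ∎
  where
  open ≡-Reasoning
  Z Z′ B S₀ S₁ S₂ : PowerSeries
  Z  = evenSpread (ballot (suc (suc e)) i)
  Z′ = evenSpread (ballot (suc e) (suc i))
  B  = below (suc e) i
  S₀ = scaledRevCoef e
  S₁ = scaledRevCoef (suc e)
  S₂ = scaledRevCoef (suc (suc e))
  add-cancel : ∀ a b → a ≡ a +ℤ b -ℤ b
  add-cancel = solve-∀ℤ
  simplify : ∀ a b → + 2 *ℤ (a +ℤ + 2 *ℤ b) -ℤ + 4 *ℤ b ≡ + 2 *ℤ a
  simplify = solve-∀ℤ
  shift²-⊙ : ∀ c f → shift² (c ⊙ f) ≋ c ⊙ shift² f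
  shift²-⊙ c f zero          = sym (ℤₚ.*-zeroʳ c)
  shift²-⊙ c f (suc zero)    = sym (ℤₚ.*-zeroʳ c)
  shift²-⊙ c f (suc (suc n)) = refl
  conv-shift²ˡ : ∀ f g → conv (shift² f) g ≋ shift² (conv f g)
  conv-shift²ˡ f g n = trans (conv-shiftˡ (shift f) g n) (shift-cong (conv-shiftˡ f g) n)
  conv-shift²ʳ : ∀ f g → conv f (shift² g) ≋ shift² (conv f g)
  conv-shift²ʳ f g n = trans (conv-shiftʳ f (shift g) n) (shift-cong (conv-shiftʳ f g) n)
  recurrenceʳ : conv Z S₂ m +ℤ + 4 *ℤ shift² (conv Z S₀) m ≡ + 2 *ℤ conv Z S₁ m
  recurrenceʳ = begin
    conv Z S₂ m +ℤ + 4 *ℤ shift² (conv Z S₀) m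
      ≡⟨ cong (λ c → conv Z S₂ m +ℤ + 4 *ℤ c) (conv-shift²ʳ Z S₀ m) ⟨
    conv Z S₂ m +ℤ + 4 *ℤ conv Z (shift² S₀) m
      ≡⟨ cong (conv Z S₂ m +ℤ_) (conv-⊙ʳ (+ 4) Z (shift² S₀) m) ⟨
    conv Z S₂ m +ℤ conv Z (+ 4 ⊙ shift² S₀) m
      ≡⟨ conv-⊕ʳ Z S₂ (+ 4 ⊙ shift² S₀) m ⟨
    conv Z (S₂ ⊕ + 4 ⊙ shift² S₀) m
      ≡⟨ conv-cong {Z} (λ _ → refl) (scaledRevCoef-recurrence e) m ⟩
    conv Z (+ 2 ⊙ S₁) m
      ≡⟨ conv-⊙ʳ (+ 2) Z S₁ m ⟩
    + 2 *ℤ conv Z S₁ m ∎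
  recurrenceˡ : conv Z S₁ m ≡ conv B S₁ m +ℤ + 2 *ℤ shift² (conv Z S₀) m
  recurrenceˡ = begin
    conv Z S₁ m
      ≡⟨ conv-cong {g = S₁} (evenSpread-ballot (suc e) i) (λ _ → refl) m ⟩
    conv (B ⊕ shift² Z′) S₁ m
      ≡⟨ conv-⊕ˡ B (shift² Z′) S₁ m ⟩
    conv B S₁ m +ℤ conv (shift² Z′) S₁ m
      ≡⟨ cong (conv B S₁ m +ℤ_) (conv-shift²ˡ Z′ S₁ m) ⟩
    conv B S₁ m +ℤ shift² (conv Z′ S₁) m
      ≡⟨ cong (conv B S₁ m +ℤ_) (shift-cong (shift-cong (conv-evenSpread-ballot e (suc i))) m) ⟩
    conv B S₁ m +ℤ shift² (+ 2 ⊙ conv Z S₀) m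
      ≡⟨ cong (conv B S₁ m +ℤ_) (shift²-⊙ (+ 2) (conv Z S₀) m) ⟩
    conv B S₁ m +ℤ + 2 *ℤ shift² (conv Z S₀) m ∎

-- The factor 2 compares the scalings 2^(e+1) and 2^e of the two polynomials.
ballot-chebyshev : ∀ e →
  conv (evenSpread (ballot (suc e) 0)) (scaledRevCoef (suc e)) ≋ + 2 ⊙ scaledRevCoef e
ballot-chebyshev e m = trans (conv-evenSpread-ballot e 0 m) (cong (+ 2 *ℤ_) (conv-oneˡ (scaledRevCoef e) m))

theorem1p2 : (ks : List ℕ) → All (λ m → 1 ≤ m) ks → 1 ≤ length ks →
    let p = length ks
        k = sum ks
        T = p123 ∷ w ks ∷ []
    in (p ≡ 1 → ((∀ n → 2 * k ∸ 2 < n → avoidCount T n ≡ 0) × avoidCount T (2 * k ∸ 2) ≢ 0))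
       × (p ≡ 2 → ∀ m → conv (evenSpread (avoidCount T)) (scaledRevCoef k) m ≡ (+ 2) *ℤ scaledRevCoef (k ∸ 1) m)
       × (3 ≤ p → ∀ n → avoidCount T n ≡ catalan n)
theorem1p2 (suc k ∷ []) _ _ = (λ _ → one-layer (suc (k + 0)) (cong suc (ℕₚ.+-identityʳ k))) , (λ ()) , λ { (s≤s ()) }
  where
  T₁ = p123 ∷ w (suc k ∷ []) ∷ []
  -- `sum` yields suc (k + 0); abstracting it as s lets it be replaced by suc k throughout.
  one-layer : ∀ s → s ≡ suc k → (∀ n → 2 * s ∸ 2 < n → avoidCount T₁ n ≡ 0) × avoidCount T₁ (2 * s ∸ 2) ≢ 0
  one-layer _ refl = avoidCount-1-layer-vanishes (suc k) , avoidCount-1-layer-nonzero k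
theorem1p2 (suc r ∷ suc s ∷ []) _ _ = (λ ()) , two-layers , λ { (s≤s (s≤s ())) }
  where
  counts : ∀ n → avoidCount (p123 ∷ w (suc r ∷ suc s ∷ []) ∷ []) n ≡ ballot (suc (r + suc (s + 0))) 0 n
  counts n = trans (avoidCount-2-layers r s n) (cong (λ e → ballot e 0 n) (size r s))
    where
    size : ∀ r s → s + suc (suc r) ≡ suc (r + suc (s + 0))
    size = solve-∀
  two-layers : 2 ≡ 2 → ∀ m →
    conv (evenSpread (avoidCount (p123 ∷ w (suc r ∷ suc s ∷ []) ∷ []))) (scaledRevCoef (suc (r + suc (s + 0)))) m ≡
    (+ 2) *ℤ scaledRevCoef (r + suc (s + 0)) m
  two-layers _ m = trans
    (conv-cong {g = scaledRevCoef (suc (r + suc (s + 0)))} (evenSpread-cong counts) (λ _ → refl) m)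
    (ballot-chebyshev (r + suc (s + 0)) m)
theorem1p2 (suc m₁ ∷ suc m₂ ∷ suc m₃ ∷ ks) _ _ = (λ ()) , (λ ()) , λ _ n →
  avoidCount-ascents (w (suc m₁ ∷ suc m₂ ∷ suc m₃ ∷ ks)) n (3-layers-ascents 0 m₁ m₂ m₃ ks)
theorem1p2 (zero ∷ _)                   (() ∷ _)
theorem1p2 (suc _ ∷ zero ∷ _)           (_ ∷ () ∷ _)
theorem1p2 (suc _ ∷ suc _ ∷ zero ∷ _)   (_ ∷ _ ∷ () ∷ _)
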